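{- Let $\ell \geqslant 1$ and let $A = \{0 = a_0 < a_1 < \cdots < a_{\ell+1} = b\}$ be a finite set of integers with $\gcd(a_1,\dots,a_{\ell+1}) = 1$. If $N$ is an integer with $N \geqslant b-\ell$, then $$NA = \{0,1,\dots,bN\} \setminus \big( \mathcal{E}(A) \cup (bN - \mathcal{E}(b-A))\big).$$
   Context: For a finite set of integers $A$ and an integer $N\geqslant 1$, $NA := \{x_1+\cdots+x_N : x_1,\dots,x_N\in A\}$ is the $N$-fold sumset (summands not necessarily distinct). For a finite set $A$ of non-negative integers containing $0$, $\mathcal{P}(A) := \bigcup_{N=1}^{\infty} NA$ and $\mathcal{E}(A) := \{n \geqslant 1 : n \text{ an integer},\ n\notin \mathcal{P}(A)\}$. For an integer $m$ and a set $S$ of integers, $m - S := \{m-s : s\in S\}$; thus $b-A=\{b-a: a\in A\}$, which is again a finite set of non-negative integers containing $0$ with maximum $b$. -}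

module Defs where

open import Algebra.Properties.CommutativeMonoid.Sum using (sum)
open import Data.Fin.Base using (Fin)
open import Data.Integer.Base using (ℤ; 0ℤ; 1ℤ; _-_; _≤_)
open import Data.Integer.GCD using (gcd)
open import Data.Integer.Properties using (+-0-commutativeMonoid)
open import Data.Nat.Base as ℕ using (ℕ)
open import Data.Product.Base using (∃-syntax; _×_)
open import Data.Vec.Functional using (Vector; foldr)
open import Level using (0ℓ)
open import Relation.Binary.PropositionalEquality using (_≡_)
open import Relation.Unary using (Pred; _∈_; _∉_)

ℤSet : Set₁
ℤSet = Pred ℤ 0ℓ

range : ∀ {n} → Vector ℤ n → ℤSet
range a x = ∃[ i ] a i ≡ x

gcdᵛ : ∀ {n} → Vector ℤ n → ℤ
gcdᵛ = foldr gcd 0ℤ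

-- {0, 1, …, m}; empty when m is negative.
[0⋯_] : ℤ → ℤSet
[0⋯ m ] x = 0ℤ ≤ x × x ≤ m

infixr 8 _⋆_
infixl 7 _−_

-- The N-fold sumset NA.  For N = 0 this is {0}.
_⋆_ : ℕ → ℤSet → ℤSet
(N ⋆ A) n = ∃[ x ] (∀ (i : Fin N) → x i ∈ A) × sum +-0-commutativeMonoid x ≡ n

-- m − S = {m - s : s ∈ S}, with U+2212 to tell it from integer subtraction.
_−_ : ℤ → ℤSet → ℤSet
(m − S) x = ∃[ s ] s ∈ S × m - s ≡ x

𝒫 : ℤSet → ℤSet
𝒫 A n = ∃[ N ] 1 ℕ.≤ N × n ∈ N ⋆ A

ℰ : ℤSet → ℤSet
ℰ A n = 1ℤ ≤ n × n ∉ 𝒫 A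

{-# OPTIONS --safe #-}

-- Write A′ = A \ {0, b} and say that (n, N) is represented if n ∈ NA.  If n ∈ 𝒫(A) and
-- bN − n ∈ 𝒫(b − A), then (n, N + s) and (n + tb, N + t) are represented for some s and t, so by
-- induction on s and t it suffices that (n, N) is represented as soon as (n, N + 1) and
-- (n + b, N + 1) are.  Suppose it is not, and choose representations of these two with the fewest
-- summands in A′: then n = a₁ + ⋯ + aₖ + ub with k + u = N + 1, and n + b = c₁ + ⋯ + cₘ with m ≤ N + 1.
-- By minimality, for any order of either sequence, its prefix sums of length at least 2 are
-- distinct mod b from each other and from 0 and the elements of A′; hence k, m ≤ b − ℓ ≤ N.
-- On the other hand k + m ≥ N + 3, so the pigeonhole principle produces prefixes with
-- a₁ + ⋯ + aᵢ ≡ c₁ + ⋯ + cⱼ mod b.  Exchanging these prefixes gives two further sequences with sums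
-- ≡ n mod b, and one of them represents (n, N) unless c₁ + ⋯ + cⱼ is too small or too large
-- compared with a₁ + ⋯ + aᵢ.  This is excluded by a suitable order: for the weight
-- x ↦ k x − (a₁ + ⋯ + aₖ + b), all proper prefixes of a can be kept in (−kb, 0) and all prefixes of c
-- between 0 and the weight of c, since both intervals are longer than the spread of the weights.
module Submission where

open import Defs
import Algebra.Properties.CommutativeMonoid.Sum as Sum
open import Data.Empty using (⊥; ⊥-elim)
open import Data.Fin.Base as Fin using (Fin; zero; suc; fromℕ; inject₁)
import Data.Fin.Properties as Finₚ
open import Data.Fin.Relation.Unary.Top using (View; view; ‵fromℕ; ‵inject₁)
open import Data.Integer.Base as ℤ using (ℤ; 0ℤ; 1ℤ; ∣_∣)
import Data.Integer.Properties as ℤₚ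
open import Data.Integer.Tactic.RingSolver renaming (solve-∀ to ℤ-solve-∀)
open import Data.List.Base using (List; []; _∷_; _++_; [_]; length; take; drop; map; applyUpTo; lookup; tabulate)
open import Data.List.Membership.Propositional using () renaming (_∈_ to _∈ₗ_)
open import Data.List.Membership.Propositional.Properties using (∈-lookup; ∈-tabulate⁺; ∈-tabulate⁻)
import Data.List.Properties as Listₚ
open import Data.List.Relation.Binary.Permutation.Propositional using (_↭_; ↭-refl; ↭-sym; ↭-trans; ↭-prep; ↭-swap; ↭-reflexive)
open import Data.List.Relation.Binary.Permutation.Propositional.Properties using (All-resp-↭; ↭-length; shifts)
open import Data.List.Relation.Unary.All as All using (All; []; _∷_)
import Data.List.Relation.Unary.All.Properties as Allₚ
open import Data.List.Relation.Unary.AllPairs using (AllPairs; []; _∷_)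
import Data.List.Relation.Unary.AllPairs.Properties as AllPairsₚ
open import Data.List.Relation.Unary.Any using (Any; here; there; any?)
open import Data.Nat.Base as ℕ using (ℕ; zero; suc; z≤n; s≤s; NonZero)
open import Data.Nat.DivMod using (_/_; _%_; m≡m%n+[m/n]*n; m%n<n; m<n⇒m%n≡m)
open import Data.Nat.Induction using (Acc; acc; <-wellFounded)
open import Data.Nat.ListAction using (sum)
open import Data.Nat.ListAction.Properties using (sum-++; sum-↭)
import Data.Nat.Properties as ℕₚ
open import Data.Nat.Tactic.RingSolver renaming (solve-∀ to ℕ-solve-∀)
open import Data.Product.Base using (∃-syntax; ∃₂; _×_; _,_; proj₁; proj₂)
open import Data.Sum.Base using (_⊎_; inj₁; inj₂)
open import Data.Vec.Functional as Vec using (Vector; head; tail; last)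
open import Relation.Binary.Core using (_Preserves_⟶_)
open import Relation.Binary.PropositionalEquality using (_≡_; _≢_; refl; sym; trans; cong; cong₂; subst; subst₂; module ≡-Reasoning)
open import Relation.Nullary using (¬_; Dec; yes; no)
open import Relation.Nullary.Decidable using (_×-dec_; map′; decidable-stable)
open import Relation.Unary using (_≐_; _∖_; _∪_; _∈_)

-- Orders of a list that keep its prefix weights in an interval.

extract : ∀ {X : Set} {P : X → Set} {xs} → Any P xs → ∃₂ λ x ys → P x × x ∷ ys ↭ xs
extract {xs = x ∷ xs} (here px) = x , xs , px , ↭-refl
extract {xs = x ∷ xs} (there p) with y , ys , py , y∷ys↭xs ← extract p =
  y , x ∷ ys , py , ↭-trans (↭-swap y x ↭-refl) (↭-prep x y∷ys↭xs)

module Ordering {X : Set} (f : X → ℤ) where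
  open import Data.Integer.Base using (_+_; _≤_; _<_)

  weight : List X → ℤ
  weight []       = 0ℤ
  weight (x ∷ xs) = f x + weight xs

  weight-↭ : ∀ {xs ys} → xs ↭ ys → weight xs ≡ weight ys
  weight-↭ _↭_.refl = refl
  weight-↭ (_↭_.prep x p) = cong (f x +_) (weight-↭ p)
  weight-↭ (_↭_.swap x y p) = trans (cong (λ w → f x + (f y + w)) (weight-↭ p)) (exchange (f x) (f y) _)
    where
    exchange : ∀ i j k → i + (j + k) ≡ j + (i + k)
    exchange = ℤ-solve-∀
  weight-↭ (_↭_.trans p q) = trans (weight-↭ p) (weight-↭ q)

  weight≤0 : ∀ {xs} → All (λ x → f x ≤ 0ℤ) xs → weight xs ≤ 0ℤ
  weight≤0 []       = ℤₚ.≤-refl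
  weight≤0 (p ∷ ps) = ℤₚ.+-mono-≤ p (weight≤0 ps)

  weight≥0 : ∀ {xs} → All (λ x → 0ℤ ≤ f x) xs → 0ℤ ≤ weight xs
  weight≥0 []       = ℤₚ.≤-refl
  weight≥0 (p ∷ ps) = ℤₚ.+-mono-≤ p (weight≥0 ps)

  weight<0⇒∃<0 : ∀ xs → weight xs < 0ℤ → Any (λ x → f x < 0ℤ) xs
  weight<0⇒∃<0 xs w<0 with any? (λ x → f x ℤₚ.<? 0ℤ) xs
  ... | yes p = p
  ... | no ¬p = ⊥-elim (ℤₚ.<⇒≱ w<0 (weight≥0 (All.map ℤₚ.≮⇒≥ (Allₚ.¬Any⇒All¬ xs ¬p))))

  module _ {α β lo hi : ℤ} (spread : hi + α ≤ lo + β) where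

    Bounded : X → Set
    Bounded x = lo ≤ f x × f x ≤ hi

    Inside : ℤ → Set
    Inside w = α ≤ w × w ≤ β

    private
      -- Two steps differ by at most `hi - lo`, which `spread` bounds by `β - α`; hence steps from
      -- the same `w` cannot leave the interval on opposite sides.
      below : ∀ w x y → Bounded x → Bounded y → w + f x < α → ¬ Inside (w + f y) → w + f y < α
      below w x y (lo≤fx , _) (_ , fy≤hi) w+fx<α outside = ℤₚ.≰⇒> λ α≤w+fy →
        outside (α≤w+fy , ℤₚ.≮⇒≥ λ β<w+fy →
          ℤₚ.<-irrefl (eq w (f x) (f y) lo hi α β)
            (ℤₚ.+-mono-<-≤ (ℤₚ.+-mono-< w+fx<α β<w+fy) (ℤₚ.+-mono-≤ (ℤₚ.+-mono-≤ lo≤fx fy≤hi) spread)))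
        where
        eq : ∀ w x y lo hi α β →
          w + x + β + (lo + y + (hi + α)) ≡ α + (w + y) + (x + hi + (lo + β))
        eq = ℤ-solve-∀

      above : ∀ w x y → Bounded x → Bounded y → β < w + f x → ¬ Inside (w + f y) → β < w + f y
      above w x y (_ , fx≤hi) (lo≤fy , _) β<w+fx outside = ℤₚ.≰⇒> λ w+fy≤β →
        outside (ℤₚ.≮⇒≥ (λ w+fy<α →
          ℤₚ.<-irrefl (eq w (f x) (f y) lo hi α β)
            (ℤₚ.+-mono-<-≤ (ℤₚ.+-mono-< β<w+fx w+fy<α) (ℤₚ.+-mono-≤ (ℤₚ.+-mono-≤ lo≤fy fx≤hi) spread))) , w+fy≤β)
        where
        eq : ∀ w x y lo hi α β →
          β + (w + y) + (lo + x + (hi + α)) ≡ w + x + α + (y + hi + (lo + β))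
        eq = ℤ-solve-∀

      drops : ∀ {w} x → α ≤ w → w + f x < α → f x < 0ℤ
      drops {w} x α≤w w+fx<α = ℤₚ.≰⇒> λ 0≤fx → ℤₚ.<⇒≱ w+fx<α
        (ℤₚ.≤-trans α≤w (subst (_≤ w + f x) (ℤₚ.+-identityʳ w) (ℤₚ.+-monoʳ-≤ w 0≤fx)))

      rises : ∀ {w} x → w ≤ β → β < w + f x → 0ℤ < f x
      rises {w} x w≤β β<w+fx = ℤₚ.≰⇒> λ fx≤0 → ℤₚ.<⇒≱ β<w+fx
        (ℤₚ.≤-trans (subst (w + f x ≤_) (ℤₚ.+-identityʳ w) (ℤₚ.+-monoʳ-≤ w fx≤0)) w≤β)

    -- If every step leaves [α, β], then by the spread bound they all leave it on the same side, so
    -- that the total weight overshoots by at least 2.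
    ∃-inside : ∀ {w x y xs} → Inside w → All Bounded (x ∷ y ∷ xs) →
      α ≤ 1ℤ + (w + weight (x ∷ y ∷ xs)) → w + weight (x ∷ y ∷ xs) ≤ 1ℤ + β →
      Any (λ z → Inside (w + f z)) (x ∷ y ∷ xs)
    ∃-inside {w} {x} {y} {xs} (α≤w , w≤β) (bx ∷ by ∷ bxs) α≤end end≤β
      with any? (λ z → (α ℤₚ.≤? (w + f z)) ×-dec ((w + f z) ℤₚ.≤? β)) (x ∷ y ∷ xs)
    ... | yes found = found
    ... | no ¬found with Allₚ.¬Any⇒All¬ _ ¬found | α ℤₚ.≤? (w + f x)
    ...   | x-out ∷ y-out ∷ out | no α≰ = ⊥-elim (ℤₚ.<-irrefl (eq w (f x) (f y) (weight xs) α)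
              (ℤₚ.+-mono-≤-< (ℤₚ.+-mono-≤ (ℤₚ.i<j⇒suc[i]≤j low) α≤end)
                 (ℤₚ.+-mono-<-≤ (drops y α≤w (below w x y bx by low y-out))
                   (weight≤0 (All.zipWith (λ {z} (bz , z-out) → ℤₚ.<⇒≤ (drops z α≤w (below w x z bx bz low z-out))) (bxs , out))))))
      where
      low = ℤₚ.≰⇒> α≰
      eq : ∀ w x y s α → 1ℤ + (w + x) + α + (y + s) ≡ α + (1ℤ + (w + (x + (y + s)))) + 0ℤ
      eq = ℤ-solve-∀
    ...   | x-out ∷ y-out ∷ out | yes α≤ = ⊥-elim (ℤₚ.<-irrefl (eq w (f x) (f y) (weight xs) β)
              (ℤₚ.+-mono-≤-< (ℤₚ.+-mono-≤ (ℤₚ.i<j⇒suc[i]≤j high) end≤β)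
                 (ℤₚ.+-mono-<-≤ (rises y w≤β (above w x y bx by high y-out))
                   (weight≥0 (All.zipWith (λ {z} (bz , z-out) → ℤₚ.<⇒≤ (rises z w≤β (above w x z bx bz high z-out))) (bxs , out))))))
      where
      high = ℤₚ.≰⇒> (λ ≤β → x-out (α≤ , ≤β))
      eq : ∀ w x y s β → 1ℤ + β + (w + (x + (y + s))) + 0ℤ ≡ w + x + (1ℤ + β) + (y + s)
      eq = ℤ-solve-∀

    -- The total weight may miss [α, β] by 1, which is why the last element is set apart.
    reorder : ∀ n {w} xs → length xs ≡ suc n → Inside w → All Bounded xs →
      α ≤ 1ℤ + (w + weight xs) → w + weight xs ≤ 1ℤ + β →
      ∃₂ λ ys z → ys ++ [ z ] ↭ xs × (∀ i → i ℕ.≤ length ys → Inside (w + weight (take i ys)))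
    reorder zero {w} (x ∷ []) _ inside _ _ _ = [] , x , ↭-refl , λ where
      zero _ → subst Inside (sym (ℤₚ.+-identityʳ w)) inside
    reorder (suc n) {w} xs@(_ ∷ _ ∷ _) |xs|≡ inside bounded α≤end end≤β
      -- Greedy choice: the next element is one whose step stays inside. The walk over the remaining
      -- elements has the same end point, so the conditions on the end carry over.
      with x , xs′ , inside′ , x∷xs′↭xs ← extract (∃-inside inside bounded α≤end end≤β)
      with _ ∷ bounded′ ← All-resp-↭ (↭-sym x∷xs′↭xs) bounded
      with end ← trans (cong (w +_) (sym (weight-↭ x∷xs′↭xs))) (sym (ℤₚ.+-assoc w (f x) (weight xs′)))
      with ys , z , ys∷z↭xs′ , prefixes ← reorder n xs′ (ℕₚ.suc-injective (trans (↭-length x∷xs′↭xs) |xs|≡))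
             inside′ bounded′ (subst (λ e → α ≤ 1ℤ + e) end α≤end) (subst (_≤ 1ℤ + β) end end≤β)
      = x ∷ ys , z , ↭-trans (↭-prep x ys∷z↭xs′) x∷xs′↭xs , λ where
          zero    _         → subst Inside (sym (ℤₚ.+-identityʳ w)) inside
          (suc i) (s≤s i≤n) → subst Inside (ℤₚ.+-assoc w (f x) _) (prefixes i i≤n)

-- Prefixes of lists, and differences of natural numbers.

AllPairs-lookup : ∀ {X : Set} {R : X → X → Set} {xs} → AllPairs R xs →
  ∀ {i j} → i Fin.< j → R (lookup xs i) (lookup xs j)
AllPairs-lookup (px ∷ _) {zero}  {suc j} _         = All.lookup px (∈-lookup j)
AllPairs-lookup (_ ∷ ps) {suc i} {suc j} (s≤s i<j) = AllPairs-lookup ps i<j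

length-take-≤ : ∀ {X : Set} i (xs : List X) → i ℕ.≤ length xs → length (take i xs) ≡ i
length-take-≤ i xs i≤ = trans (Listₚ.length-take i xs) (ℕₚ.m≤n⇒m⊓n≡m i≤)

take-++-≤ : ∀ {X : Set} i (xs ys : List X) → i ℕ.≤ length xs → take i (xs ++ ys) ≡ take i xs
take-++-≤ zero    xs       ys _       = refl
take-++-≤ (suc i) (x ∷ xs) ys (s≤s p) = cong (x ∷_) (take-++-≤ i xs ys p)

module Differences where
  open import Data.Integer.Base using (+_)
  open import Data.Nat.Base using (_+_; _≤_)

  -- Weights are written as differences of naturals; this lemma and its converse move their
  -- inequalities to `ℕ` without truncated subtraction.
  diff-mono-≤ : ∀ p q r s → p + s ≤ r + q → + p ℤ.- + q ℤ.≤ + r ℤ.- + s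
  diff-mono-≤ p q r s p+s≤r+q = subst₂ ℤ._≤_ (eq₁ (+ p) (+ q) (+ s)) (eq₂ (+ q) (+ r) (+ s))
    (ℤₚ.+-monoˡ-≤ (ℤ.- + q ℤ.- + s) (ℤ.+≤+ p+s≤r+q))
    where
    eq₁ : ∀ p q s → p ℤ.+ s ℤ.+ (ℤ.- q ℤ.- s) ≡ p ℤ.- q
    eq₁ = ℤ-solve-∀
    eq₂ : ∀ q r s → r ℤ.+ q ℤ.+ (ℤ.- q ℤ.- s) ≡ r ℤ.- s
    eq₂ = ℤ-solve-∀

  diff-cancel-≤ : ∀ p q r s → + p ℤ.- + q ℤ.≤ + r ℤ.- + s → p + s ≤ r + q
  diff-cancel-≤ p q r s p-q≤r-s = ℤₚ.drop‿+≤+ (subst₂ ℤ._≤_ (eq₁ (+ p) (+ q) (+ s)) (eq₂ (+ q) (+ r) (+ s))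
    (ℤₚ.+-monoˡ-≤ (+ q ℤ.+ + s) p-q≤r-s))
    where
    eq₁ : ∀ p q s → p ℤ.- q ℤ.+ (q ℤ.+ s) ≡ p ℤ.+ s
    eq₁ = ℤ-solve-∀
    eq₂ : ∀ q r s → r ℤ.- s ℤ.+ (q ℤ.+ s) ≡ r ℤ.+ q
    eq₂ = ℤ-solve-∀

  diff-+ : ∀ p q r s → (+ p ℤ.- + q) ℤ.+ (+ r ℤ.- + s) ≡ + (p + r) ℤ.- + (q + s)
  diff-+ p q r s = eq (+ p) (+ q) (+ r) (+ s)
    where
    eq : ∀ p q r s → (p ℤ.- q) ℤ.+ (r ℤ.- s) ≡ (p ℤ.+ r) ℤ.- (q ℤ.+ s)
    eq = ℤ-solve-∀

-- Orders for the weight `k * x - T`.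

module Weighted (k T b : ℕ) where
  open import Data.Integer.Base using (+_)
  open import Data.Nat.Base using (_+_; _*_; _≤_; _<_)
  open Differences

  -- Up to the factor `k`, which keeps the values integral, this compares a term with `T / k`; for
  -- the list in `reorder-below` that number exceeds the mean by `b / k`.
  f : ℕ → ℤ
  f x = + (k * x) ℤ.- + T

  open Ordering f

  weight-sum : ∀ xs → weight xs ≡ + (k * sum xs) ℤ.- + (T * length xs)
  weight-sum []       = sym (cong₂ (λ p q → + p ℤ.- + q) (ℕₚ.*-zeroʳ k) (ℕₚ.*-zeroʳ T))
  weight-sum (x ∷ xs) = begin
    f x ℤ.+ weight xs                                          ≡⟨ cong (λ w → f x ℤ.+ w) (weight-sum xs) ⟩
    f x ℤ.+ (+ (k * sum xs) ℤ.- + (T * length xs))             ≡⟨ diff-+ (k * x) T (k * sum xs) (T * length xs) ⟩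
    + (k * x + k * sum xs) ℤ.- + (T + T * length xs)           ≡⟨ cong₂ (λ p q → + p ℤ.- + q) (ℕₚ.*-distribˡ-+ k x (sum xs)) (ℕₚ.*-suc T (length xs)) ⟨
    + (k * (x + sum xs)) ℤ.- + (T * suc (length xs))           ∎
    where open ≡-Reasoning

  bounds : ∀ {x} → 1 ≤ x × x < b → + k ℤ.- + T ℤ.≤ f x × f x ℤ.≤ + (k * b) ℤ.- + (k + T)
  bounds {x} (1≤x , x<b) =
    diff-mono-≤ k T (k * x) T (ℕₚ.+-monoˡ-≤ T (subst (_≤ k * x) (ℕₚ.*-identityʳ k) (ℕₚ.*-monoʳ-≤ k 1≤x))) ,
    diff-mono-≤ (k * x) T (k * b) (k + T) (begin
      k * x + (k + T)  ≡⟨ eq k x T ⟩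
      k * suc x + T    ≤⟨ ℕₚ.+-monoˡ-≤ T (ℕₚ.*-monoʳ-≤ k x<b) ⟩
      k * b + T        ∎)
    where
    open ℕₚ.≤-Reasoning
    eq : ∀ k x T → k * x + (k + T) ≡ k * suc x + T
    eq = ℕ-solve-∀

  weight-take : ∀ i xs → i ≤ length xs → weight (take i xs) ≡ + (k * sum (take i xs)) ℤ.- + (T * i)
  weight-take i xs i≤ = trans (weight-sum (take i xs))
    (cong (λ l → + (k * sum (take i xs)) ℤ.- + (T * l)) (length-take-≤ i xs i≤))

  -- The walk starts at 0 and ends at `G`, both ends of the interval to be kept, and the weights of
  -- single terms spread over `k * b - 2 * k`, which is at most `G`.
  reorder-above : ∀ G xs → 1 ≤ length xs → All (λ x → 1 ≤ x × x < b) xs →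
    k * b ≤ G → k * sum xs ≡ T * length xs + G →
    ∃[ ys ] ys ↭ xs × (∀ i → i ≤ length ys →
      T * i ≤ k * sum (take i ys) × k * sum (take i ys) ≤ T * i + G)
  reorder-above G xs@(_ ∷ xs′) 1≤ bnd kb≤G total =
    append (reorder {α = 0ℤ} {β = + G} {lo = + k ℤ.- + T} {hi = + (k * b) ℤ.- + (k + T)}
      spread (length xs′) {w = 0ℤ} xs refl (ℤₚ.≤-refl , ℤ.+≤+ z≤n) (All.map bounds bnd)
      (subst (λ w → 0ℤ ℤ.≤ 1ℤ ℤ.+ w) (sym end) (ℤ.+≤+ z≤n))
      (subst (ℤ._≤ 1ℤ ℤ.+ + G) (sym end) (ℤ.+≤+ (ℕₚ.n≤1+n G))))
    where
    end : 0ℤ ℤ.+ weight xs ≡ + G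
    end = begin
      0ℤ ℤ.+ weight xs                                        ≡⟨ ℤₚ.+-identityˡ _ ⟩
      weight xs                                               ≡⟨ weight-sum xs ⟩
      + (k * sum xs) ℤ.- + (T * length xs)                    ≡⟨ cong (λ p → + p ℤ.- + (T * length xs)) total ⟩
      + (T * length xs) ℤ.+ + G ℤ.- + (T * length xs)         ≡⟨ eq (+ (T * length xs)) (+ G) ⟩
      + G                                                     ∎
      where
      open ≡-Reasoning
      eq : ∀ t g → t ℤ.+ g ℤ.- t ≡ g
      eq = ℤ-solve-∀

    spread : (+ (k * b) ℤ.- + (k + T)) ℤ.+ 0ℤ ℤ.≤ (+ k ℤ.- + T) ℤ.+ + G
    spread = subst₂ ℤ._≤_ (sym (ℤₚ.+-identityʳ _)) (eq (+ k) (+ T) (+ G))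
      (diff-mono-≤ (k * b) (k + T) (k + G) T (begin
        k * b + T          ≤⟨ ℕₚ.+-monoˡ-≤ T kb≤G ⟩
        G + T              ≤⟨ ℕₚ.m≤n+m (G + T) (k + k) ⟩
        k + k + (G + T)    ≡⟨ eq′ k G T ⟩
        k + G + (k + T)    ∎))
      where
      open ℕₚ.≤-Reasoning
      eq : ∀ k T G → k ℤ.+ G ℤ.- T ≡ (k ℤ.- T) ℤ.+ G
      eq = ℤ-solve-∀
      eq′ : ∀ k G T → k + k + (G + T) ≡ k + G + (k + T)
      eq′ = ℕ-solve-∀

    append : (∃₂ λ ys z → ys ++ [ z ] ↭ xs × (∀ i → i ≤ length ys → 0ℤ ℤ.≤ 0ℤ ℤ.+ weight (take i ys) × 0ℤ ℤ.+ weight (take i ys) ℤ.≤ + G)) →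
      ∃[ ys ] ys ↭ xs × (∀ i → i ≤ length ys →
        T * i ≤ k * sum (take i ys) × k * sum (take i ys) ≤ T * i + G)
    append (ys , z , yz↭xs , pre) = ys ++ [ z ] , yz↭xs , prefix
      where
      prefix : ∀ i → i ≤ length (ys ++ [ z ]) → T * i ≤ k * sum (take i (ys ++ [ z ])) × k * sum (take i (ys ++ [ z ])) ≤ T * i + G
      prefix i i≤ with i ℕₚ.≤? length ys
      ... | yes i≤ys rewrite take-++-≤ i ys [ z ] i≤ys = lower , upper
        where
        pre′ = subst (λ w → 0ℤ ℤ.≤ w × w ℤ.≤ + G) (trans (ℤₚ.+-identityˡ _) (weight-take i ys i≤ys)) (pre i i≤ys)
        lower : T * i ≤ k * sum (take i ys)
        lower = subst (T * i ≤_) (ℕₚ.+-identityʳ _) (diff-cancel-≤ 0 0 (k * sum (take i ys)) (T * i) (proj₁ pre′))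
        upper : k * sum (take i ys) ≤ T * i + G
        upper = subst₂ _≤_ (ℕₚ.+-identityʳ _) (ℕₚ.+-comm G (T * i)) (diff-cancel-≤ (k * sum (take i ys)) (T * i) G 0
          (subst (+ (k * sum (take i ys)) ℤ.- + (T * i) ℤ.≤_) (sym (ℤₚ.+-identityʳ _)) (proj₂ pre′)))
      -- The only prefix not covered by `reorder` is the whole list, and its weight is exactly `G`.
      ... | no i≰ys = subst (T * i ≤_) (sym whole) (ℕₚ.m≤m+n _ G) , ℕₚ.≤-reflexive whole
        where
        i≥ : length (ys ++ [ z ]) ≤ i
        i≥ = ℕₚ.≤-trans (ℕₚ.≤-reflexive (trans (Listₚ.length-++ ys) (ℕₚ.+-comm (length ys) 1))) (ℕₚ.≰⇒> i≰ys)
        whole : k * sum (take i (ys ++ [ z ])) ≡ T * i + G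
        whole = begin
          k * sum (take i (ys ++ [ z ]))  ≡⟨ cong (λ l → k * sum l) (Listₚ.take-all i (ys ++ [ z ]) i≥) ⟩
          k * sum (ys ++ [ z ])           ≡⟨ cong (k *_) (sum-↭ yz↭xs) ⟩
          k * sum xs                      ≡⟨ total ⟩
          T * length xs + G               ≡⟨ cong (λ l → T * l + G) (trans (sym (↭-length yz↭xs)) (ℕₚ.≤-antisym i≥ i≤)) ⟩
          T * i + G                       ∎
          where open ≡-Reasoning

  -- The walk starts at 0 and ends at `- k * b`, each just outside the interval from `1 - k * b` to
  -- `- 1`. At the start, an element of negative weight is put first; `T ≤ k * b` keeps it above
  -- `- k * b`. At the end, the tolerance of 1 in `reorder` suffices.
  reorder-below : ∀ xs → 2 ≤ length xs → All (λ x → 1 ≤ x × x < b) xs → length xs ≡ k →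
    T ≡ sum xs + b → T ≤ k * b →
    ∃[ ys ] ys ↭ xs × (∀ i → 1 ≤ i → i < length ys →
      k * sum (take i ys) < T * i × T * i < k * sum (take i ys) + k * b)
  reorder-below xs@(_ ∷ _) 2≤ bnd@((_ , x<b) ∷ _) |xs|≡k T≡ T≤kb = start (extract (weight<0⇒∃<0 xs weight<0))
    where
    1≤k : 1 ≤ k
    1≤k = ℕₚ.≤-trans (s≤s z≤n) (subst (2 ≤_) |xs|≡k 2≤)

    total : weight xs ≡ + 0 ℤ.- + (k * b)
    total = begin
      weight xs                                               ≡⟨ weight-sum xs ⟩
      + (k * sum xs) ℤ.- + (T * length xs)                    ≡⟨ cong (λ q → + (k * sum xs) ℤ.- + q) (trans (cong₂ _*_ T≡ |xs|≡k) (dist k (sum xs) b)) ⟩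
      + (k * sum xs) ℤ.- (+ (k * sum xs) ℤ.+ + (k * b))       ≡⟨ eq (+ (k * sum xs)) (+ (k * b)) ⟩
      + 0 ℤ.- + (k * b)                                       ∎
      where
      open ≡-Reasoning
      eq : ∀ t g → t ℤ.- (t ℤ.+ g) ≡ 0ℤ ℤ.- g
      eq = ℤ-solve-∀
      dist : ∀ k s b → (s + b) * k ≡ k * s + k * b
      dist = ℕ-solve-∀

    1≤kb : 1 ≤ k * b
    1≤kb = ℕₚ.*-mono-≤ 1≤k (ℕₚ.≤-trans (s≤s z≤n) x<b)

    weight<0 : weight xs ℤ.< 0ℤ
    weight<0 = subst (ℤ._< 0ℤ) (sym total) (ℤₚ.suc[i]≤j⇒i<j
      (subst (ℤ._≤ 0ℤ) (ℤₚ.+-assoc 1ℤ 0ℤ (ℤ.- + (k * b))) (diff-mono-≤ 1 (k * b) 0 0 1≤kb)))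

    α β : ℤ
    α = + 1 ℤ.- + (k * b)
    β = + 0 ℤ.- + 1

    spread : (+ (k * b) ℤ.- + (k + T)) ℤ.+ α ℤ.≤ (+ k ℤ.- + T) ℤ.+ β
    spread = subst₂ ℤ._≤_ (sym (diff-+ (k * b) (k + T) 1 (k * b))) (sym (diff-+ k T 0 1))
      (diff-mono-≤ (k * b + 1) (k + T + k * b) (k + 0) (T + 1) (begin
        k * b + 1 + (T + 1)          ≡⟨ eq (k * b) T ⟩
        (1 + 1) + (k * b + T)        ≤⟨ ℕₚ.+-monoˡ-≤ (k * b + T) (ℕₚ.+-mono-≤ 1≤k 1≤k) ⟩
        (k + k) + (k * b + T)        ≡⟨ eq′ k (k * b) T ⟩
        k + 0 + (k + T + k * b)      ∎))
      where
      open ℕₚ.≤-Reasoning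
      eq : ∀ c T → c + 1 + (T + 1) ≡ (1 + 1) + (c + T)
      eq = ℕ-solve-∀
      eq′ : ∀ k c T → (k + k) + (c + T) ≡ k + 0 + (k + T + c)
      eq′ = ℕ-solve-∀

    Goal : Set
    Goal = ∃[ ys ] ys ↭ xs × (∀ i → 1 ≤ i → i < length ys →
      k * sum (take i ys) < T * i × T * i < k * sum (take i ys) + k * b)

    append : ∀ y {xs′} → y ∷ xs′ ↭ xs →
      (∃₂ λ ys z → ys ++ [ z ] ↭ xs′ × (∀ i → i ≤ length ys → α ℤ.≤ f y ℤ.+ weight (take i ys) × f y ℤ.+ weight (take i ys) ℤ.≤ β)) → Goal
    append y y∷xs′↭xs (ys , z , yz↭xs′ , pre) = (y ∷ ys) ++ [ z ] , ↭-trans (↭-prep y yz↭xs′) y∷xs′↭xs , prefix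
      where
      prefix : ∀ i → 1 ≤ i → i < length ((y ∷ ys) ++ [ z ]) →
        k * sum (take i ((y ∷ ys) ++ [ z ])) < T * i × T * i < k * sum (take i ((y ∷ ys) ++ [ z ])) + k * b
      prefix (suc i) _ i<
        with i≤ys ← ℕₚ.≤-pred (ℕₚ.≤-pred (subst (suc (suc i) ≤_) (cong suc (trans (Listₚ.length-++ ys) (ℕₚ.+-comm (length ys) 1))) i<))
        rewrite take-++-≤ i ys [ z ] i≤ys
        with lower , upper ← subst (λ w → α ℤ.≤ w × w ℤ.≤ β) (weight-take (suc i) (y ∷ ys) (s≤s i≤ys)) (pre i i≤ys)
        = subst (_≤ T * suc i) (ℕₚ.+-comm _ 1) (diff-cancel-≤ (k * sum (y ∷ take i ys)) (T * suc i) 0 1 upper)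
        , diff-cancel-≤ 1 (k * b) (k * sum (y ∷ take i ys)) (T * suc i) lower

    start : (∃₂ λ y xs′ → f y ℤ.< 0ℤ × y ∷ xs′ ↭ xs) → Goal
    start (y , [] , _ , p) with () ← ℕₚ.≤-pred (subst (2 ≤_) (sym (↭-length p)) 2≤)
    start (y , xs′@(_ ∷ xs″) , fy<0 , p) with (1≤y , _) ∷ bnd′ ← All-resp-↭ (↭-sym p) bnd =
      append y p (reorder {α = α} {β = β} {lo = + k ℤ.- + T} {hi = + (k * b) ℤ.- + (k + T)}
        spread (length xs″) {w = f y} xs′ refl
        (diff-mono-≤ 1 (k * b) (k * y) T (ℕₚ.+-mono-≤ (ℕₚ.*-mono-≤ 1≤k 1≤y) T≤kb) , ℤₚ.i<j⇒i≤pred[j] fy<0)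
        (All.map bounds bnd′)
        (ℤₚ.≤-reflexive (trans (ℤₚ.+-assoc 1ℤ 0ℤ (ℤ.- + (k * b))) (cong (ℤ._+_ 1ℤ) (sym end))))
        (subst (ℤ._≤ 1ℤ ℤ.+ β) (sym end) (diff-mono-≤ 0 (k * b) 0 0 z≤n)))
      where
      end : f y ℤ.+ weight xs′ ≡ + 0 ℤ.- + (k * b)
      end = trans (weight-↭ p) total

-- Inequalities between prefix weights, and congruence modulo `b`.

module Arithmetic where
  open import Data.Nat.Base using (_+_; _*_; _∸_; _≤_; _<_)

  -- σ, τ are the sums and i, j the lengths of the exchanged prefixes; an exchange that does not
  -- represent (n, N) satisfies the hypotheses of one of the next two lemmas.
  exchange-left : ∀ {k b T E} → k * b ≡ E + T → ∀ {i j σ τ Q} → σ ≡ τ + Q * b → i ≤ j + Q →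
    k * σ < T * i → ¬ T * j ≤ k * τ
  exchange-left {k} {b} {T} {E} kb≡ {i} {j} {σ} {τ} {Q} σ≡ i≤ kσ<Ti Tj≤kτ = ℕₚ.<-irrefl refl (begin-strict
    -- In terms of weights, `k * σ - T * i` is at least `k * τ - T * j` plus `Q * E`, so it cannot
    -- be negative while `k * τ - T * j` is nonnegative.
    k * σ                    <⟨ kσ<Ti ⟩
    T * i                    ≤⟨ ℕₚ.*-monoʳ-≤ T i≤ ⟩
    T * (j + Q)              ≡⟨ ℕₚ.*-distribˡ-+ T j Q ⟩
    T * j + T * Q            ≤⟨ ℕₚ.+-mono-≤ Tj≤kτ (ℕₚ.*-monoˡ-≤ Q (ℕₚ.m≤n+m T E)) ⟩
    k * τ + (E + T) * Q      ≡⟨ cong (λ c → k * τ + c * Q) kb≡ ⟨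
    k * τ + k * b * Q        ≡⟨ eq k τ b Q ⟩
    k * (τ + Q * b)          ≡⟨ cong (k *_) σ≡ ⟨
    k * σ                    ∎)
    where
    open ℕₚ.≤-Reasoning
    eq : ∀ k τ b Q → k * τ + k * b * Q ≡ k * (τ + Q * b)
    eq = ℕ-solve-∀

  exchange-right : ∀ {k b T E X Y G} → k * b ≡ E + T → X * E + Y * T ≡ k * b + G →
    ∀ {i j σ τ P} → τ ≡ σ + P * b → j + Y ≤ i + P → X ≤ P →
    T * i < k * σ + k * b → ¬ k * τ ≤ T * j + G
  exchange-right {k} {b} {T} {E} {X} {Y} {G} kb≡ D≡ {i} {j} {σ} {τ} {P} τ≡ j+Y≤ X≤P Ti< kτ≤ =
    ℕₚ.<-irrefl refl (begin-strict
      -- In terms of weights, `k * τ - T * j` is at least `k * σ - T * i` plus `X * E + Y * T`. The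
      -- first summand exceeds `- k * b` and the second is `k * b + G`, so the total exceeds `G`.
      k * τ + k * b                        ≤⟨ ℕₚ.+-monoˡ-≤ (k * b) kτ≤ ⟩
      T * j + G + k * b                    ≡⟨ eq₁ (T * j) G (k * b) ⟩
      T * j + (k * b + G)                  ≡⟨ cong (T * j +_) D≡ ⟨
      T * j + (X * E + Y * T)              ≡⟨ eq₂ T j X E Y ⟩
      X * E + T * (j + Y)                  ≤⟨ ℕₚ.+-mono-≤ (ℕₚ.*-monoˡ-≤ E X≤P) (ℕₚ.*-monoʳ-≤ T j+Y≤) ⟩
      P * E + T * (i + P)                  ≡⟨ eq₃ T i P E ⟩
      T * i + P * (E + T)                  ≡⟨ cong (λ c → T * i + P * c) kb≡ ⟨
      T * i + P * (k * b)                  <⟨ ℕₚ.+-monoˡ-< (P * (k * b)) Ti< ⟩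
      k * σ + k * b + P * (k * b)          ≡⟨ eq₄ k σ b P ⟩
      k * (σ + P * b) + k * b              ≡⟨ cong (λ c → k * c + k * b) τ≡ ⟨
      k * τ + k * b                        ∎)
    where
    open ℕₚ.≤-Reasoning
    eq₁ : ∀ p q r → p + q + r ≡ p + (r + q)
    eq₁ = ℕ-solve-∀
    eq₂ : ∀ T j X E Y → T * j + (X * E + Y * T) ≡ X * E + T * (j + Y)
    eq₂ = ℕ-solve-∀
    eq₃ : ∀ T i P E → P * E + T * (i + P) ≡ T * i + P * (E + T)
    eq₃ = ℕ-solve-∀
    eq₄ : ∀ k σ b P → k * σ + k * b + P * (k * b) ≡ k * (σ + P * b) + k * b
    eq₄ = ℕ-solve-∀

  -- Ties go to the first alternative. The positive multiple in the second one provides the copy of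
  -- `b` that leads from `n + b` back to `n` in `c-swap-sum`.
  %-≡⇒ : ∀ x y b .{{_ : NonZero b}} → x % b ≡ y % b →
    (∃[ q ] x ≡ y + q * b) ⊎ (∃[ q ] y ≡ x + suc q * b)
  %-≡⇒ x y b x≡y with ℕₚ.≤-<-connex (y / b) (x / b)
  ... | inj₁ y/b≤x/b = inj₁ (x / b ∸ y / b , (begin
      x                                                    ≡⟨ m≡m%n+[m/n]*n x b ⟩
      x % b + x / b * b                                    ≡⟨ cong₂ (λ r q → r + q * b) x≡y (sym (ℕₚ.m+[n∸m]≡n y/b≤x/b)) ⟩
      y % b + (y / b + (x / b ∸ y / b)) * b                ≡⟨ eq (y % b) (y / b) (x / b ∸ y / b) b ⟩
      y % b + y / b * b + (x / b ∸ y / b) * b              ≡⟨ cong (_+ (x / b ∸ y / b) * b) (m≡m%n+[m/n]*n y b) ⟨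
      y + (x / b ∸ y / b) * b                              ∎))
    where
    open ≡-Reasoning
    eq : ∀ r p q b → r + (p + q) * b ≡ r + p * b + q * b
    eq = ℕ-solve-∀
  ... | inj₂ x/b<y/b = inj₂ (y / b ∸ suc (x / b) , (begin
      y                                                    ≡⟨ m≡m%n+[m/n]*n y b ⟩
      y % b + y / b * b                                    ≡⟨ cong₂ (λ r q → r + q * b) (sym x≡y) (sym (ℕₚ.m+[n∸m]≡n x/b<y/b)) ⟩
      x % b + (suc (x / b) + (y / b ∸ suc (x / b))) * b    ≡⟨ eq (x % b) (x / b) (y / b ∸ suc (x / b)) b ⟩
      x % b + x / b * b + suc (y / b ∸ suc (x / b)) * b    ≡⟨ cong (_+ suc (y / b ∸ suc (x / b)) * b) (m≡m%n+[m/n]*n x b) ⟨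
      x + suc (y / b ∸ suc (x / b)) * b                    ∎))
    where
    open ≡-Reasoning
    eq : ∀ r p q b → r + (suc p + q) * b ≡ r + p * b + suc q * b
    eq = ℕ-solve-∀

-- Representations by inner elements and copies of `b`.

module Representations (b : ℕ) .{{_ : NonZero b}} (A′ : List ℕ)
  (A′-bounds : ∀ {x} → x ∈ₗ A′ → 1 ℕ.≤ x × x ℕ.< b) (A′-distinct : AllPairs _≢_ A′) where
  open import Data.Nat.Base using (_+_; _*_; _∸_; _≤_; _<_)
  open Arithmetic

  -- xs holds the summands in A′ and u counts the summands b; the remaining N − length xs − u are 0.
  Repr : ℕ → ℕ → List ℕ → ℕ → Set
  Repr n N xs u = All (_∈ₗ A′) xs × sum xs + u * b ≡ n × length xs + u ≤ N

  Rep : ℕ → ℕ → Set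
  Rep n N = ∃₂ (Repr n N)

  Minimal : ℕ → ℕ → List ℕ → ℕ → Set
  Minimal n N xs u = Repr n N xs u × (∀ ys v → Repr n N ys v → length xs ≤ length ys)

  -- Descent on the length without deciding whether a shorter representation exists; hence only a
  -- double negation.
  ¬¬-minimal : ∀ {n N} → Rep n N → ¬ ¬ ∃₂ (Minimal n N)
  ¬¬-minimal {n} {N} (xs , u , r) ¬min = go (<-wellFounded (length xs)) u r
    where
    go : ∀ {xs} → Acc _<_ (length xs) → ∀ u → ¬ Repr n N xs u
    go (acc rec) u r = ¬min (_ , u , r , λ ys v r′ → ℕₚ.≮⇒≥ λ ys<xs → go (rec ys<xs) v r′)

  Minimal-↭ : ∀ {n N xs ys u} → ys ↭ xs → Minimal n N xs u → Minimal n N ys u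
  Minimal-↭ {u = u} p ((xs∈ , total , len) , least) =
    (All-resp-↭ (↭-sym p) xs∈ , trans (cong (_+ u * b) (sum-↭ p)) total , subst (λ l → l + u ≤ _) (sym (↭-length p)) len) ,
    λ zs v r → subst (_≤ length zs) (sym (↭-length p)) (least zs v r)

  -- Each summand is at most `b - 1`; the gain of 1 per summand is what makes later comparisons with
  -- multiples of `b` strict.
  sum-bound : ∀ {xs} → All (_∈ₗ A′) xs → sum xs + length xs ≤ length xs * b
  sum-bound []                     = z≤n
  sum-bound {x ∷ xs} (x∈ ∷ xs∈) = begin
    x + sum xs + suc (length xs)    ≡⟨ eq x (sum xs) (length xs) ⟩
    suc x + (sum xs + length xs)    ≤⟨ ℕₚ.+-mono-≤ (proj₂ (A′-bounds x∈)) (sum-bound xs∈) ⟩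
    b + length xs * b               ∎
    where
    open ℕₚ.≤-Reasoning
    eq : ∀ x s l → x + s + suc l ≡ suc x + (s + l)
    eq = ℕ-solve-∀

  -- Replacing I by I₂ together with j copies of b shortens the representation.
  irreplaceable : ∀ {n N xs u} → Minimal n N xs u → ∀ I R {I₂} j → xs ↭ I ++ R → All (_∈ₗ A′) I₂ →
    length I₂ ≤ 1 → length I₂ < length I → sum I ≢ sum I₂ + j * b
  irreplaceable {n} {N} {xs} {u} ((xs∈ , total , len) , least) I R {I₂} j p I₂∈ |I₂|≤1 |I₂|<|I| sum≡ =
    ℕₚ.<⇒≱ shorter (least (I₂ ++ R) (u + j) (Allₚ.++⁺ I₂∈ R∈ , total′ , len′))
    where
    IR∈ = All-resp-↭ p xs∈
    I∈ = Allₚ.++⁻ˡ I IR∈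
    R∈ = Allₚ.++⁻ʳ I IR∈
    |xs|≡ : length xs ≡ length I + length R
    |xs|≡ = trans (↭-length p) (Listₚ.length-++ I)
    shorter : length (I₂ ++ R) < length xs
    shorter = subst₂ _<_ (sym (Listₚ.length-++ I₂)) (sym |xs|≡) (ℕₚ.+-monoˡ-< (length R) |I₂|<|I|)
    total′ : sum (I₂ ++ R) + (u + j) * b ≡ n
    total′ = begin
      sum (I₂ ++ R) + (u + j) * b             ≡⟨ cong (_+ (u + j) * b) (sum-++ I₂ R) ⟩
      sum I₂ + sum R + (u + j) * b            ≡⟨ eq (sum I₂) (sum R) u j b ⟩
      sum I₂ + j * b + sum R + u * b          ≡⟨ cong (λ s → s + sum R + u * b) sum≡ ⟨
      sum I + sum R + u * b                   ≡⟨ cong (_+ u * b) (trans (sum-↭ p) (sum-++ I R)) ⟨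
      sum xs + u * b                          ≡⟨ total ⟩
      n                                       ∎
      where
      open ≡-Reasoning
      eq : ∀ s r u j b → s + r + (u + j) * b ≡ s + j * b + r + u * b
      eq = ℕ-solve-∀
    -- The sum of the nonempty `I` is strictly less than `length I * b`, so the `j` copies of `b`
    -- and the at most one summand in `I₂` need no more places than `I`.
    j<|I| : j < length I
    j<|I| = ℕₚ.*-cancelʳ-< b j (length I) (begin-strict
      j * b                  ≤⟨ ℕₚ.m≤n+m (j * b) (sum I₂) ⟩
      sum I₂ + j * b         ≡⟨ sum≡ ⟨
      sum I                  ≡⟨ ℕₚ.+-identityʳ _ ⟨
      sum I + 0              <⟨ ℕₚ.+-monoʳ-< (sum I) (ℕₚ.≤-trans (s≤s z≤n) |I₂|<|I|) ⟩
      sum I + length I       ≤⟨ sum-bound I∈ ⟩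
      length I * b           ∎)
      where open ℕₚ.≤-Reasoning
    len′ : length (I₂ ++ R) + (u + j) ≤ N
    len′ = begin
      length (I₂ ++ R) + (u + j)           ≡⟨ cong (_+ (u + j)) (Listₚ.length-++ I₂) ⟩
      length I₂ + length R + (u + j)       ≤⟨ ℕₚ.+-monoˡ-≤ (u + j) (ℕₚ.+-monoˡ-≤ (length R) |I₂|≤1) ⟩
      1 + length R + (u + j)               ≡⟨ eq (length R) u j ⟩
      suc j + length R + u                 ≤⟨ ℕₚ.+-monoˡ-≤ u (ℕₚ.+-monoˡ-≤ (length R) j<|I|) ⟩
      length I + length R + u              ≡⟨ cong (_+ u) |xs|≡ ⟨
      length xs + u                        ≤⟨ len ⟩
      N                                    ∎
      where
      open ℕₚ.≤-Reasoning
      eq : ∀ r u j → 1 + r + (u + j) ≡ suc j + r + u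
      eq = ℕ-solve-∀

  -- Residues of prefix sums.

  Apart : List ℕ → List ℕ → Set
  Apart xs ys = sum xs % b ≢ sum ys % b

  apart-length : ∀ {xss} → AllPairs Apart xss → length xss ≤ b
  apart-length {xss} apart = ℕₚ.≮⇒≥ λ b<len →
    let i , j , i<j , same = Finₚ.pigeonhole b<len (λ i → Fin.fromℕ< (m%n<n (sum (lookup xss i)) b))
    in AllPairs-lookup apart i<j (trans (sym (Finₚ.toℕ-fromℕ< _)) (trans (cong Fin.toℕ same) (Finₚ.toℕ-fromℕ< _)))

  -- 0 and the elements of `A′` are encoded as lists of length at most 1, so that their residues can
  -- be counted together with those of prefixes.
  letters : List (List ℕ)
  letters = [] ∷ map [_] A′

  ∈⇒% : ∀ {x} → x ∈ₗ A′ → (x + 0) % b ≡ x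
  ∈⇒% {x} x∈ = trans (cong (_% b) (ℕₚ.+-identityʳ x)) (m<n⇒m%n≡m (proj₂ (A′-bounds x∈)))

  0%b : 0 % b ≡ 0
  0%b = m<n⇒m%n≡m (ℕ.>-nonZero⁻¹ b)

  letters-apart : AllPairs Apart letters
  letters-apart =
    Allₚ.map⁺ (All.tabulate λ {x} x∈ 0≡x → ℕₚ.<⇒≢ (proj₁ (A′-bounds x∈)) (trans (sym 0%b) (trans 0≡x (∈⇒% x∈)))) ∷
    AllPairsₚ.map⁺ (distinct (All.tabulate (λ x∈ → x∈)) A′-distinct)
    where
    distinct : ∀ {xs} → All (_∈ₗ A′) xs → AllPairs _≢_ xs → AllPairs (λ x y → Apart [ x ] [ y ]) xs
    distinct []         []       = []
    distinct (x∈ ∷ xs∈) (x∉ ∷ ps) =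
      All.zipWith (λ (y∈ , x≢y) x≡y → x≢y (trans (sym (∈⇒% x∈)) (trans x≡y (∈⇒% y∈)))) (xs∈ , x∉) ∷ distinct xs∈ ps

  -- Lengths start at 2, since the prefixes of length 0 and 1 already occur among the `letters`.
  prefixes : List ℕ → ℕ → List (List ℕ)
  prefixes xs c = applyUpTo (λ i → take (2 + i) xs) c

  module _ {n N xs u} (min : Minimal n N xs u) where

    -- A prefix congruent to 0 or to some `x` in `A′` could be replaced by nothing or by `x`,
    -- together with copies of `b`.
    prefix-apart-letters : ∀ i → 2 ≤ i → i ≤ length xs → All (Apart (take i xs)) letters
    prefix-apart-letters i 2≤i i≤ =
      (λ same → irreplaceable min (take i xs) (drop i xs) (sum (take i xs) / b) split [] z≤n
        (ℕₚ.≤-trans (s≤s z≤n) 2≤len) (trans (m≡m%n+[m/n]*n (sum (take i xs)) b) (cong (_+ sum (take i xs) / b * b) (trans same 0%b)))) ∷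
      Allₚ.map⁺ (All.tabulate λ {x} x∈ same → irreplaceable min (take i xs) (drop i xs) (sum (take i xs) / b) split (x∈ ∷ []) ℕₚ.≤-refl
        2≤len (trans (m≡m%n+[m/n]*n (sum (take i xs)) b) (cong (_+ sum (take i xs) / b * b) (trans (trans same (∈⇒% x∈)) (sym (ℕₚ.+-identityʳ x))))))
      where
      split = ↭-reflexive (sym (Listₚ.take++drop≡id i xs))
      2≤len : 2 ≤ length (take i xs)
      2≤len = subst (2 ≤_) (sym (length-take-≤ i xs i≤)) 2≤i

    -- The block between two congruent prefixes has a sum divisible by `b`, so copies of `b` alone
    -- could replace it.
    prefixes-apart : ∀ i j → i < j → j ≤ length xs → Apart (take i xs) (take j xs)
    prefixes-apart i j i<j j≤ same with %-≡⇒ (sum (take j xs)) (sum (take i xs)) b (sym same)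
    ... | inj₁ (q , eq) = irreplaceable min middle (take i xs ++ drop j xs) q split [] z≤n
            (subst (0 <_) (sym |middle|≡) (ℕₚ.m<n⇒0<n∸m i<j))
            (ℕₚ.+-cancelˡ-≡ (sum (take i xs)) _ _ (trans (sym sum-middle) eq))
      where
      middle = drop i (take j xs)
      take≡ : take j xs ≡ take i xs ++ middle
      take≡ = trans (sym (Listₚ.take++drop≡id i (take j xs)))
        (cong (_++ middle) (trans (Listₚ.take-take i j xs) (cong (λ l → take l xs) (ℕₚ.m≤n⇒m⊓n≡m (ℕₚ.<⇒≤ i<j)))))
      sum-middle : sum (take j xs) ≡ sum (take i xs) + sum middle
      sum-middle = trans (cong sum take≡) (sum-++ (take i xs) middle)
      |middle|≡ : length middle ≡ j ∸ i
      |middle|≡ = trans (Listₚ.length-drop i (take j xs)) (cong (_∸ i) (length-take-≤ j xs j≤))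
      split : xs ↭ middle ++ take i xs ++ drop j xs
      split = ↭-trans (↭-reflexive (trans (sym (Listₚ.take++drop≡id j xs)) (trans (cong (_++ drop j xs) take≡) (Listₚ.++-assoc (take i xs) middle (drop j xs)))))
        (shifts (take i xs) middle)
    -- Impossible, because the longer prefix has at least the sum of the shorter one.
    ... | inj₂ (q , eq) = ℕₚ.<⇒≱ (ℕₚ.m<m+n (sum (take j xs)) (ℕₚ.<-≤-trans (ℕ.>-nonZero⁻¹ b) (ℕₚ.m≤m+n b (q * b))))
            (subst (_≤ sum (take j xs)) eq (sum-take-mono i j xs (ℕₚ.<⇒≤ i<j)))
      where
      sum-take-mono : ∀ i j xs → i ≤ j → sum (take i xs) ≤ sum (take j xs)
      sum-take-mono zero    j       xs       _       = z≤n
      sum-take-mono (suc i) (suc j) []       _       = z≤n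
      sum-take-mono (suc i) (suc j) (x ∷ xs) (s≤s p) = ℕₚ.+-monoʳ-≤ x (sum-take-mono i j xs p)

    prefixes-AllPairs : ∀ c → suc c ≤ length xs → AllPairs Apart (prefixes xs c)
    prefixes-AllPairs c c< = AllPairsₚ.applyUpTo⁺₁ _ c λ {i} {j} i<j j<c →
      prefixes-apart (2 + i) (2 + j) (s≤s (s≤s i<j)) (ℕₚ.≤-trans (s≤s j<c) c<)

    prefixes-letters : ∀ c → suc c ≤ length xs → All (λ p → All (Apart p) letters) (prefixes xs c)
    prefixes-letters c c< = Allₚ.applyUpTo⁺₁ _ c λ {i} i<c →
      prefix-apart-letters (2 + i) (s≤s (s≤s z≤n)) (ℕₚ.≤-trans (s≤s i<c) c<)

    -- For nonempty `xs`, the `length xs - 1` prefixes of length at least 2 and the `1 + length A′`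
    -- letters have distinct residues.
    length-minimal : length xs + length A′ ≤ b
    length-minimal = go (length xs) refl
      where
      go : ∀ l → length xs ≡ l → l + length A′ ≤ b
      go zero    _   = ℕₚ.<⇒≤ (subst (λ l → suc l ≤ b) (Listₚ.length-map [_] A′) (apart-length letters-apart))
      go (suc c) |xs|≡ = subst (_≤ b) len
        (apart-length (AllPairsₚ.++⁺ (prefixes-AllPairs c (ℕₚ.≤-reflexive (sym |xs|≡))) letters-apart (prefixes-letters c (ℕₚ.≤-reflexive (sym |xs|≡)))))
        where
        len : length (prefixes xs c ++ letters) ≡ suc c + length A′
        len = trans (Listₚ.length-++ (prefixes xs c)) (trans (cong₂ (λ p q → p + suc q) (Listₚ.length-applyUpTo _ c) (Listₚ.length-map [_] A′)) (ℕₚ.+-suc c _))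

  -- The exchange argument.

  module _ {n N} (b≤ : b ≤ N + length A′) (¬rep : ¬ Rep n N) where

    -- Both representations fill `N + 1` places once zeros are counted. This yields enough prefixes
    -- for a coincidence modulo `b`, and the chosen orders make some exchange at it fit into `N`
    -- places.
    no-minimal-pair : ∀ {as u cs} → Minimal n (suc N) as u → ¬ Minimal (n + b) (suc N) cs 0
    no-minimal-pair {as} {u} {cs} min-a@((as∈ , a-total , a-len) , _) min-c@((cs∈ , c-total , c-len) , _) =
      contradict (reorder-below as 2≤k (All.map A′-bounds as∈) refl refl T≤kb)
                 (reorder-above G cs (ℕₚ.≤-trans (s≤s z≤n) u+2≤m) (All.map A′-bounds cs∈) kb≤G c-weight)
      where
      k = length as
      m = length cs
      T = sum as + b
      -- `z` counts the zeros in the second representation, as `u` counts the copies of `b` in the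
      -- first. The shifts by one come from `n + b`: it gives `sum cs ≡ sum as + X * b`, and then
      -- `m + Y ≡ k + X`.
      z = suc N ∸ m
      X = suc u
      Y = suc z

      k+u≡ : k + u ≡ suc N
      k+u≡ = ℕₚ.≤-antisym a-len (ℕₚ.≰⇒> λ k+u≤N → ¬rep (as , u , as∈ , a-total , k+u≤N))

      m+z≡ : m + z ≡ suc N
      m+z≡ = ℕₚ.m+[n∸m]≡n (subst (_≤ suc N) (ℕₚ.+-identityʳ m) c-len)

      m+Y≡k+X : m + Y ≡ k + X
      m+Y≡k+X = trans (ℕₚ.+-suc m z) (trans (cong suc (trans m+z≡ (sym k+u≡))) (sym (ℕₚ.+-suc k u)))

      length≤N : ∀ {l} → l + length A′ ≤ b → l ≤ N
      length≤N l+≤ = ℕₚ.+-cancelʳ-≤ (length A′) _ N (ℕₚ.≤-trans l+≤ b≤)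

      complement≥1 : ∀ {l v} → l + v ≡ suc N → l ≤ N → 1 ≤ v
      complement≥1 {l} {zero}  l+0≡ l≤N = ⊥-elim (ℕₚ.<⇒≱ (ℕₚ.≤-reflexive (trans (sym l+0≡) (ℕₚ.+-identityʳ l))) l≤N)
      complement≥1 {l} {suc v} _    _   = s≤s z≤n

      -- The bound on `N` first enters here: both lists have at most `N` elements, so of the `N + 1`
      -- places at least one holds a `b` in the first representation and at least one is zero in the
      -- second.
      2≤X : 2 ≤ X
      2≤X = s≤s (complement≥1 k+u≡ (length≤N (length-minimal min-a)))

      2≤Y : 2 ≤ Y
      2≤Y = s≤s (complement≥1 m+z≡ (length≤N (length-minimal min-c)))

      sum-c : sum cs ≡ sum as + X * b
      sum-c = begin
        sum cs                  ≡⟨ ℕₚ.+-identityʳ _ ⟨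
        sum cs + 0              ≡⟨ c-total ⟩
        n + b                   ≡⟨ cong (_+ b) a-total ⟨
        sum as + u * b + b      ≡⟨ eq (sum as) u b ⟩
        sum as + X * b          ∎
        where
        open ≡-Reasoning
        eq : ∀ s u b → s + u * b + b ≡ s + suc u * b
        eq = ℕ-solve-∀

      c-bound : sum as + X * b + m ≤ m * b
      c-bound = subst (λ s → s + m ≤ m * b) sum-c (sum-bound cs∈)

      -- The `m` terms of `cs` are each less than `b`, but add up to at least `X * b`, which is
      -- positive.
      u+2≤m : suc X ≤ m
      u+2≤m = ℕₚ.≰⇒> λ m≤X → m≢0 (ℕₚ.n≤0⇒n≡0 (m≤0 m≤X))
        where
        m≤0 : m ≤ X → m ≤ 0
        m≤0 m≤X = ℕₚ.+-cancelˡ-≤ (m * b) m 0 (begin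
          m * b + m                     ≤⟨ ℕₚ.+-monoˡ-≤ m (ℕₚ.*-monoˡ-≤ b m≤X) ⟩
          X * b + m                     ≤⟨ ℕₚ.+-monoˡ-≤ m (ℕₚ.m≤n+m (X * b) (sum as)) ⟩
          sum as + X * b + m            ≤⟨ c-bound ⟩
          m * b                         ≡⟨ ℕₚ.+-identityʳ _ ⟨
          m * b + 0                     ∎)
          where open ℕₚ.≤-Reasoning
        m≢0 : m ≢ 0
        m≢0 m≡0 = ℕₚ.<⇒≱ (ℕ.>-nonZero⁻¹ b) (begin
          b                             ≤⟨ ℕₚ.m≤m+n b (u * b) ⟩
          X * b                         ≤⟨ ℕₚ.m≤n+m (X * b) (sum as) ⟩
          sum as + X * b                ≤⟨ ℕₚ.m≤m+n _ m ⟩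
          sum as + X * b + m            ≤⟨ c-bound ⟩
          m * b                         ≡⟨ cong (_* b) m≡0 ⟩
          0                             ∎)
          where open ℕₚ.≤-Reasoning

      -- This is `c-bound` after trading `m` for `k` by `m + Y ≡ k + X`; it yields `T ≤ k * b` and
      -- `Y ≤ k`.
      slack : sum as + Y * b + m ≤ k * b
      slack = ℕₚ.+-cancelʳ-≤ (X * b) _ _ (begin
        sum as + Y * b + m + X * b      ≡⟨ eq₁ (sum as) Y b m X ⟩
        sum as + X * b + m + Y * b      ≤⟨ ℕₚ.+-monoˡ-≤ (Y * b) c-bound ⟩
        m * b + Y * b                   ≡⟨ ℕₚ.*-distribʳ-+ b m Y ⟨
        (m + Y) * b                     ≡⟨ cong (_* b) m+Y≡k+X ⟩
        (k + X) * b                     ≡⟨ ℕₚ.*-distribʳ-+ b k X ⟩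
        k * b + X * b                   ∎)
        where
        open ℕₚ.≤-Reasoning
        eq₁ : ∀ s Y b m X → s + Y * b + m + X * b ≡ s + X * b + m + Y * b
        eq₁ = ℕ-solve-∀

      T≤kb : T ≤ k * b
      T≤kb = begin
        sum as + b              ≤⟨ ℕₚ.+-monoʳ-≤ (sum as) (ℕₚ.m≤m+n b (z * b)) ⟩
        sum as + Y * b          ≤⟨ ℕₚ.m≤m+n _ m ⟩
        sum as + Y * b + m      ≤⟨ slack ⟩
        k * b                   ∎
        where open ℕₚ.≤-Reasoning

      2≤k : 2 ≤ k
      2≤k = ℕₚ.≤-trans 2≤Y (ℕₚ.*-cancelʳ-≤ Y k b (begin
        Y * b                   ≤⟨ ℕₚ.m≤n+m (Y * b) (sum as) ⟩
        sum as + Y * b          ≤⟨ ℕₚ.m≤m+n _ m ⟩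
        sum as + Y * b + m      ≤⟨ slack ⟩
        k * b                   ∎))
        where open ℕₚ.≤-Reasoning

      -- `E` is the weight of `b`, and `- T` is the weight of 0. Since `E + T ≡ k * b`, the number
      -- `G` below equals `u * E + z * T`; it is at least `k * b` as `u` and `z` are positive, and
      -- by `c-weight` it is the weight of `cs`.
      E = k * b ∸ T

      kb≡E+T : k * b ≡ E + T
      kb≡E+T = sym (ℕₚ.m∸n+n≡m T≤kb)

      D = X * E + Y * T

      2kb≤D : k * b + k * b ≤ D
      2kb≤D = begin
        k * b + k * b               ≡⟨ cong₂ _+_ kb≡E+T kb≡E+T ⟩
        (E + T) + (E + T)           ≡⟨ eq E T ⟩
        2 * E + 2 * T               ≤⟨ ℕₚ.+-mono-≤ (ℕₚ.*-monoˡ-≤ E 2≤X) (ℕₚ.*-monoˡ-≤ T 2≤Y) ⟩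
        D                           ∎
        where
        open ℕₚ.≤-Reasoning
        eq : ∀ E T → (E + T) + (E + T) ≡ 2 * E + 2 * T
        eq = ℕ-solve-∀

      G = D ∸ k * b

      D≡ : D ≡ k * b + G
      D≡ = sym (ℕₚ.m+[n∸m]≡n (ℕₚ.≤-trans (ℕₚ.m≤m+n (k * b) (k * b)) 2kb≤D))

      kb≤G : k * b ≤ G
      kb≤G = ℕₚ.+-cancelˡ-≤ (k * b) _ _ (subst (k * b + k * b ≤_) D≡ 2kb≤D)

      c-weight : k * sum cs ≡ T * m + G
      c-weight = ℕₚ.+-cancelʳ-≡ (k * b) _ _ (begin
        k * sum cs + k * b                  ≡⟨ cong (λ s → k * s + k * b) sum-c ⟩
        k * (sum as + X * b) + k * b        ≡⟨ eq₁ k (sum as) X b ⟩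
        k * T + X * (k * b)                 ≡⟨ cong (λ c → k * T + X * c) kb≡E+T ⟩
        k * T + X * (E + T)                 ≡⟨ eq₂ k T X E ⟩
        T * (k + X) + X * E                 ≡⟨ cong (λ c → T * c + X * E) m+Y≡k+X ⟨
        T * (m + Y) + X * E                 ≡⟨ eq₃ T m Y (X * E) ⟩
        T * m + D                           ≡⟨ cong (T * m +_) D≡ ⟩
        T * m + (k * b + G)                 ≡⟨ eq₄ (T * m) (k * b) G ⟩
        T * m + G + k * b                   ∎)
        where
        open ≡-Reasoning
        eq₁ : ∀ k s X b → k * (s + X * b) + k * b ≡ k * (s + b) + X * (k * b)
        eq₁ = ℕ-solve-∀
        eq₂ : ∀ k T X E → k * T + X * (E + T) ≡ T * (k + X) + X * E
        eq₂ = ℕ-solve-∀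
        eq₃ : ∀ T m Y c → T * (m + Y) + c ≡ T * m + (c + Y * T)
        eq₃ = ℕ-solve-∀
        eq₄ : ∀ p q r → p + (q + r) ≡ p + r + q
        eq₄ = ℕ-solve-∀

      open Weighted k T b

      contradict :
        (∃[ as′ ] as′ ↭ as × (∀ i → 1 ≤ i → i < length as′ →
          k * sum (take i as′) < T * i × T * i < k * sum (take i as′) + k * b)) →
        (∃[ cs′ ] cs′ ↭ cs × (∀ j → j ≤ length cs′ →
          T * j ≤ k * sum (take j cs′) × k * sum (take j cs′) ≤ T * j + G)) → ⊥
      contradict (as′ , as′↭as , a-weights) (cs′ , cs′↭cs , c-weights) = ℕₚ.<⇒≱ too-long (apart-length
        (AllPairsₚ.++⁺ (prefixes-AllPairs min-a′ k′ k′<)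
          (AllPairsₚ.++⁺ (prefixes-AllPairs min-c′ m′ m′<) letters-apart (prefixes-letters min-c′ m′ m′<))
          (All.zipWith (λ (p , q) → Allₚ.++⁺ p q)
            ( Allₚ.applyUpTo⁺₁ _ k′ (λ {i} i<k′ → Allₚ.applyUpTo⁺₁ _ m′ λ {j} j<m′ →
                cross (2 + i) (2 + j) (s≤s z≤n) (subst (2 + i <_) (sym |as′|≡) (s≤s (s≤s i<k′))) (ℕₚ.≤-trans (s≤s j<m′) m′<))
            , prefixes-letters min-a′ k′ k′<))))
        where
        min-a′ = Minimal-↭ as′↭as min-a
        min-c′ = Minimal-↭ cs′↭cs min-c
        -- The whole of `as′` is left out, being congruent to the whole of `cs′`. There remain the
        -- lengths 2 to `k - 1` for `as′` and 2 to `m` for `cs′`.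
        k′ = k ∸ 2
        m′ = m ∸ 1

        |as′|≡ : length as′ ≡ 2 + k′
        |as′|≡ = trans (↭-length as′↭as) (sym (ℕₚ.m+[n∸m]≡n 2≤k))

        |cs′|≡ : length cs′ ≡ 1 + m′
        |cs′|≡ = trans (↭-length cs′↭cs) (sym (ℕₚ.m+[n∸m]≡n (ℕₚ.≤-trans (s≤s z≤n) u+2≤m)))

        k′< : suc k′ ≤ length as′
        k′< = subst (suc k′ ≤_) (sym |as′|≡) (ℕₚ.n≤1+n _)

        m′< : suc m′ ≤ length cs′
        m′< = ℕₚ.≤-reflexive (sym |cs′|≡)

        -- By `u + 2 ≤ m` the `(k - 2) + (m - 1) + 1 + length A′` lists number at least
        -- `k + u + length A′`, which is `N + 1 + length A′`.
        too-long : b < length (prefixes as′ k′ ++ (prefixes cs′ m′ ++ letters))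
        too-long = begin-strict
          b                                          ≤⟨ b≤ ⟩
          N + length A′                              <⟨ ℕₚ.+-monoˡ-≤ (length A′) (ℕₚ.≤-reflexive (sym k+u≡)) ⟩
          k + u + length A′                          ≡⟨ cong (λ l → l + u + length A′) (ℕₚ.m+[n∸m]≡n 2≤k) ⟨
          2 + k′ + u + length A′                     ≡⟨ eq₁ k′ u (length A′) ⟩
          k′ + (X + suc (length A′))                 ≤⟨ ℕₚ.+-monoʳ-≤ k′ (ℕₚ.+-monoˡ-≤ _ (ℕₚ.∸-monoˡ-≤ 1 u+2≤m)) ⟩
          k′ + (m′ + suc (length A′))                ≡⟨ cong₂ (λ p q → p + q) (Listₚ.length-applyUpTo _ k′) rest ⟨
          length (prefixes as′ k′) + length (prefixes cs′ m′ ++ letters) ≡⟨ Listₚ.length-++ (prefixes as′ k′) ⟨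
          length (prefixes as′ k′ ++ (prefixes cs′ m′ ++ letters)) ∎
          where
          open ℕₚ.≤-Reasoning
          eq₁ : ∀ k u l → 2 + k + u + l ≡ k + (suc u + suc l)
          eq₁ = ℕ-solve-∀
          rest : length (prefixes cs′ m′ ++ letters) ≡ m′ + suc (length A′)
          rest = trans (Listₚ.length-++ (prefixes cs′ m′)) (cong₂ (λ p q → p + suc q) (Listₚ.length-applyUpTo _ m′) (Listₚ.length-map [_] A′))

        cross : ∀ i j → 1 ≤ i → i < length as′ → j ≤ length cs′ → Apart (take i as′) (take j cs′)
        cross i j 1≤i i<k j≤m same = case (%-≡⇒ σ τ b same)
          where
          open ≡-Reasoning
          σ = sum (take i as′)
          σ′ = sum (drop i as′)
          τ = sum (take j cs′)
          τ′ = sum (drop j cs′)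
          i′ = length (drop i as′)
          j′ = length (drop j cs′)

          as′∈ : All (_∈ₗ A′) as′
          as′∈ = All-resp-↭ (↭-sym as′↭as) as∈

          cs′∈ : All (_∈ₗ A′) cs′
          cs′∈ = All-resp-↭ (↭-sym cs′↭cs) cs∈

          split-sum : ∀ l xs → sum (take l xs) + sum (drop l xs) ≡ sum xs
          split-sum l xs = trans (sym (sum-++ (take l xs) (drop l xs))) (cong sum (Listₚ.take++drop≡id l xs))

          split-length : ∀ l (xs : List ℕ) → l ≤ length xs → l + length (drop l xs) ≡ length xs
          split-length l xs l≤ = trans (cong (l +_) (Listₚ.length-drop l xs)) (ℕₚ.m+[n∸m]≡n l≤)

          a-sum : σ + σ′ + u * b ≡ n
          a-sum = trans (cong (_+ u * b) (trans (split-sum i as′) (sum-↭ as′↭as))) a-total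

          c-sum : τ + τ′ ≡ n + b
          c-sum = trans (split-sum j cs′) (trans (sum-↭ cs′↭cs) (trans (sym (ℕₚ.+-identityʳ _)) c-total))

          a-length : i + i′ + u ≡ suc N
          a-length = trans (cong (_+ u) (trans (split-length i as′ (ℕₚ.<⇒≤ i<k)) (↭-length as′↭as))) k+u≡

          c-length : j + j′ + z ≡ suc N
          c-length = trans (cong (_+ z) (trans (split-length j cs′ j≤m) (↭-length cs′↭cs))) m+z≡

          -- Exchanged sequences with total `n` must need more than `N` places, for otherwise they
          -- represent `(n, N)`.
          swapped-a : ∀ v → τ + σ′ + v * b ≡ n → ¬ suc (j + i′ + v) ≤ suc N
          swapped-a v total (s≤s len) = ¬rep (take j cs′ ++ drop i as′ , v ,
            Allₚ.++⁺ (Allₚ.take⁺ j cs′∈) (Allₚ.drop⁺ i as′∈) ,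
            trans (cong (_+ v * b) (sum-++ (take j cs′) (drop i as′))) total ,
            subst (λ l → l + v ≤ N) (sym (trans (Listₚ.length-++ (take j cs′)) (cong (_+ i′) (length-take-≤ j cs′ j≤m)))) len)

          swapped-c : ∀ v → σ + τ′ + v * b ≡ n → ¬ suc (i + j′ + v) ≤ suc N
          swapped-c v total (s≤s len) = ¬rep (take i as′ ++ drop j cs′ , v ,
            Allₚ.++⁺ (Allₚ.take⁺ i as′∈) (Allₚ.drop⁺ j cs′∈) ,
            trans (cong (_+ v * b) (sum-++ (take i as′) (drop j cs′))) total ,
            subst (λ l → l + v ≤ N) (sym (trans (Listₚ.length-++ (take i as′)) (cong (_+ j′) (length-take-≤ i as′ (ℕₚ.<⇒≤ i<k))))) len)

          case : (∃[ q ] σ ≡ τ + q * b) ⊎ (∃[ q ] τ ≡ σ + suc q * b) → ⊥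
          -- The first `j` terms of `cs′` and `Q` further copies of `b` replace the first `i` terms
          -- of `as′`; this saves a place unless `i ≤ j + Q`.
          case (inj₁ (Q , σ≡)) = exchange-left {k} {b} {T} {E} kb≡E+T σ≡ (ℕₚ.≮⇒≥ no-gain)
            (proj₁ (a-weights i 1≤i i<k)) (proj₁ (c-weights j j≤m))
            where
            eq₁ : ∀ τ σ′ u Q b → τ + σ′ + (u + Q) * b ≡ τ + Q * b + σ′ + u * b
            eq₁ = ℕ-solve-∀
            eq₂ : ∀ j i′ u Q → suc (j + Q) + i′ + u ≡ suc (j + i′ + (u + Q))
            eq₂ = ℕ-solve-∀
            no-gain : ¬ j + Q < i
            no-gain j+Q<i = swapped-a (u + Q)
              (trans (eq₁ τ σ′ u Q b) (trans (cong (λ s → s + σ′ + u * b) (sym σ≡)) a-sum))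
              (subst₂ _≤_ (eq₂ j i′ u Q) a-length (ℕₚ.+-monoˡ-≤ u (ℕₚ.+-monoˡ-≤ i′ j+Q<i)))
          -- Two exchanges fail here. Starting `cs′` with the prefix of `as′` takes `P` copies of
          -- `b`, too many places only if `j + Y ≤ i + suc P`. Given this, the opposite exchange
          -- would drop `suc P` copies of `b` and save a place, so fewer than that are present.
          case (inj₂ (P , τ≡)) = exchange-right {k} {b} {T} {E} {X} {Y} {G} kb≡E+T D≡ τ≡ j+Y≤i+P (ℕₚ.≰⇒> no-gain)
            (proj₂ (a-weights i 1≤i i<k)) (proj₂ (c-weights j j≤m))
            where
            c-swap-sum : σ + τ′ + P * b ≡ n
            c-swap-sum = ℕₚ.+-cancelʳ-≡ b _ _ (begin
              σ + τ′ + P * b + b         ≡⟨ eq σ τ′ P b ⟩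
              σ + suc P * b + τ′         ≡⟨ cong (_+ τ′) τ≡ ⟨
              τ + τ′                     ≡⟨ c-sum ⟩
              n + b                      ∎)
              where
              eq : ∀ σ τ′ P b → σ + τ′ + P * b + b ≡ σ + suc P * b + τ′
              eq = ℕ-solve-∀
            j+Y≤i+P : j + Y ≤ i + suc P
            j+Y≤i+P = ℕₚ.≮⇒≥ λ i+P<j+Y → swapped-c P c-swap-sum
              (subst₂ _≤_ (eq₁ i j′ P) (trans (eq₂ j z j′) c-length) (ℕₚ.+-monoˡ-≤ j′ (ℕₚ.≤-pred (subst₂ _≤_ (cong suc (ℕₚ.+-suc i P)) (ℕₚ.+-suc j z) i+P<j+Y))))
              where
              eq₁ : ∀ i j′ P → suc (i + P) + j′ ≡ suc (i + j′ + P)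
              eq₁ = ℕ-solve-∀
              eq₂ : ∀ j z j′ → j + z + j′ ≡ j + j′ + z
              eq₂ = ℕ-solve-∀
            no-gain : ¬ suc P ≤ u
            no-gain P<u = swapped-a v (begin
                τ + σ′ + v * b                     ≡⟨ cong (λ s → s + σ′ + v * b) τ≡ ⟩
                σ + suc P * b + σ′ + v * b         ≡⟨ eq₁ σ (suc P) b σ′ v ⟩
                σ + σ′ + (suc P + v) * b           ≡⟨ cong (λ w → σ + σ′ + w * b) u≡ ⟩
                σ + σ′ + u * b                     ≡⟨ a-sum ⟩
                n                                  ∎)
              (subst₂ _≤_ (eq₂ j i′ v) (trans (eq₃ i (suc P) i′ v) (trans (cong (i + i′ +_) u≡) a-length))
                (ℕₚ.+-monoˡ-≤ (i′ + v) (ℕₚ.≤-trans (subst (suc j ≤_) (sym (ℕₚ.+-suc j z)) (s≤s (ℕₚ.m≤m+n j z))) j+Y≤i+P)))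
              where
              v = u ∸ suc P
              u≡ : suc P + v ≡ u
              u≡ = ℕₚ.m+[n∸m]≡n P<u
              eq₁ : ∀ σ P b σ′ v → σ + P * b + σ′ + v * b ≡ σ + σ′ + (P + v) * b
              eq₁ = ℕ-solve-∀
              eq₂ : ∀ j i′ v → suc j + (i′ + v) ≡ suc (j + i′ + v)
              eq₂ = ℕ-solve-∀
              eq₃ : ∀ i P i′ v → i + P + (i′ + v) ≡ i + i′ + (P + v)
              eq₃ = ℕ-solve-∀

    descend : Rep n (suc N) → ¬ Rep (n + b) (suc N)
    descend rep-a rep-c = ¬¬-minimal rep-a λ (_ , _ , min-a) → ¬¬-minimal rep-c (from-minimal min-a)
      where
      eq : ∀ s v b → s + v * b + b ≡ s + suc v * b
      eq = ℕ-solve-∀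
      from-minimal : ∀ {as u} → Minimal n (suc N) as u → ¬ ∃₂ (Minimal (n + b) (suc N))
      from-minimal min-a (cs , zero , min-c) = no-minimal-pair min-a min-c
      -- Dropping one copy of `b` from a representation of `(n + b, N + 1)` would represent
      -- `(n, N)`.
      from-minimal min-a (cs , suc v , (cs∈ , total , len) , _) = ¬rep (cs , v , cs∈ ,
        ℕₚ.+-cancelʳ-≡ b _ _ (trans (eq (sum cs) v b) total) ,
        ℕₚ.≤-pred (subst (_≤ suc N) (ℕₚ.+-suc (length cs) v) len))

  -- Removing surplus summands.

  Rep-mono : ∀ {n N N′} → N ≤ N′ → Rep n N → Rep n N′
  Rep-mono N≤N′ (xs , u , xs∈ , total , len) = xs , u , xs∈ , total , ℕₚ.≤-trans len N≤N′

  Rep-+b : ∀ {n N} → Rep n N → Rep (n + b) (suc N)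
  Rep-+b {n} {N} (xs , u , xs∈ , total , len) = xs , suc u , xs∈ ,
    trans (eq (sum xs) u b) (cong (_+ b) total) , subst (_≤ suc N) (sym (ℕₚ.+-suc (length xs) u)) (s≤s len)
    where
    eq : ∀ s u b → s + suc u * b ≡ s + u * b + b
    eq = ℕ-solve-∀

  -- Lowering `s` gives the claim at `(n, N + 1)` and lowering `t` gives it at `(n + b, N + 1)`, the
  -- two inputs of `descend`. The calls only raise `N`, so the lower bound on it persists.
  ¬¬-Rep : ∀ {n N} s t → b ≤ N + length A′ → Rep n (N + s) → Rep (n + t * b) (N + t) → ¬ ¬ Rep n N
  ¬¬-Rep {n} {N} zero    t       _  rep-a _ ¬rep = ¬rep (subst (Rep n) (ℕₚ.+-identityʳ N) rep-a)
  ¬¬-Rep {n} {N} (suc s) zero    _  _ rep-c ¬rep = ¬rep (subst₂ Rep (ℕₚ.+-identityʳ n) (ℕₚ.+-identityʳ N) rep-c)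
  ¬¬-Rep {n} {N} (suc s) (suc t) b≤ rep-a rep-c ¬rep =
    ¬¬-Rep s (suc t) b≤′ (subst (Rep n) (ℕₚ.+-suc N s) rep-a) (Rep-mono (ℕₚ.n≤1+n _) rep-c) λ rep-a′ →
    ¬¬-Rep (suc s) t b≤′ (Rep-+b rep-a) (subst₂ Rep (sym (ℕₚ.+-assoc n b (t * b))) (ℕₚ.+-suc N t) rep-c) λ rep-c′ →
    descend b≤ ¬rep rep-a′ rep-c′
    where
    b≤′ = ℕₚ.m≤n⇒m≤1+n b≤

-- Integer sumsets.

open import Data.Integer.Base using (+_; _-_; _*_; _<_; _≥_)
open Sum ℤₚ.+-0-commutativeMonoid using () renaming (sum to ∑)

∷-⋆ : ∀ {A : ℤSet} {N x n} → x ∈ A → n ∈ N ⋆ A → (x ℤ.+ n) ∈ suc N ⋆ A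
∷-⋆ {x = x} x∈ (xs , xs∈ , total) = x Vec.∷ xs , (λ { zero → x∈ ; (suc i) → xs∈ i }) , cong (ℤ._+_ x) total

-- A search for the first summand through the finitely many indices. It serves to remove the double
-- negation left by the exchange argument.
⋆-dec : ∀ {l} (a : Vector ℤ l) N n → Dec (n ∈ N ⋆ range a)
⋆-dec a zero    n = map′ (λ 0≡n → (λ ()) , (λ ()) , 0≡n) (λ (_ , _ , 0≡n) → 0≡n) (0ℤ ℤₚ.≟ n)
⋆-dec a (suc N) n = map′ to from (Finₚ.any? λ i → ⋆-dec a N (n - a i))
  where
  to : ∃[ i ] (n - a i) ∈ N ⋆ range a → n ∈ suc N ⋆ range a
  to (i , rest) = subst (_∈ suc N ⋆ range a) (eq (a i) n) (∷-⋆ {A = range a} (i , refl) rest)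
    where
    eq : ∀ x n → x ℤ.+ (n - x) ≡ n
    eq = ℤ-solve-∀
  from : n ∈ suc N ⋆ range a → ∃[ i ] (n - a i) ∈ N ⋆ range a
  from (x , x∈ , total) with i , aᵢ≡ ← x∈ zero =
    i , tail x , (λ j → x∈ (suc j)) , trans (eq (x zero) (∑ (tail x))) (cong₂ _-_ total (sym aᵢ≡))
    where
    eq : ∀ x s → s ≡ x ℤ.+ s - x
    eq = ℤ-solve-∀

-- Translation between sumsets and representations.

module _ (ℓ : ℕ) (a : Vector ℤ (2 ℕ.+ ℓ)) (a-mono : a Preserves Fin._<_ ⟶ _<_) (a₀≡0 : head a ≡ 0ℤ) where

  private
    A = range a
    b = last a
    bℕ = ∣ b ∣

    A′ : List ℕ
    A′ = tabulate (λ (i : Fin ℓ) → ∣ a (suc (inject₁ i)) ∣)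

    a-pos : ∀ i → 0ℤ < a (suc i)
    a-pos i = subst (_< a (suc i)) a₀≡0 (a-mono (s≤s z≤n))

    abs-pos : ∀ i → + ∣ a (suc i) ∣ ≡ a (suc i)
    abs-pos i = ℤₚ.0≤i⇒+∣i∣≡i (ℤₚ.<⇒≤ (a-pos i))

    abs-mono : ∀ i j → i Fin.< j → ∣ a (suc i) ∣ ℕ.< ∣ a (suc j) ∣
    abs-mono i j i<j = ℤₚ.drop‿+<+ (subst₂ _<_ (sym (abs-pos i)) (sym (abs-pos j)) (a-mono (s≤s i<j)))

    +bℕ≡b : + bℕ ≡ b
    +bℕ≡b = abs-pos (fromℕ ℓ)

    instance
      bℕ≢0 : NonZero bℕ
      bℕ≢0 = ℕ.>-nonZero (ℤₚ.drop‿+<+ (subst (0ℤ <_) (sym +bℕ≡b) (a-pos (fromℕ ℓ))))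

    A′-bounds : ∀ {x} → x ∈ₗ A′ → 1 ℕ.≤ x × x ℕ.< bℕ
    A′-bounds x∈ with i , refl ← ∈-tabulate⁻ x∈ =
      ℤₚ.drop‿+<+ (subst (0ℤ <_) (sym (abs-pos (inject₁ i))) (a-pos (inject₁ i))) ,
      abs-mono (inject₁ i) (fromℕ ℓ) (subst₂ ℕ._<_ (sym (Finₚ.toℕ-inject₁ i)) (sym (Finₚ.toℕ-fromℕ ℓ)) (Finₚ.toℕ<n i))

    A′-distinct : AllPairs _≢_ A′
    A′-distinct = AllPairsₚ.tabulate⁺-< λ {i} {j} i<j → ℕₚ.<⇒≢
      (abs-mono (inject₁ i) (inject₁ j) (subst₂ ℕ._<_ (sym (Finₚ.toℕ-inject₁ i)) (sym (Finₚ.toℕ-inject₁ j)) i<j))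

    open Representations bℕ A′ A′-bounds A′-distinct

    0∈A : 0ℤ ∈ A
    0∈A = zero , a₀≡0

    b∈A : b ∈ A
    b∈A = fromℕ (suc ℓ) , refl

    A′⊆A : ∀ {x} → x ∈ₗ A′ → + x ∈ A
    A′⊆A x∈ with i , refl ← ∈-tabulate⁻ x∈ = suc (inject₁ i) , sym (abs-pos (inject₁ i))

    -- A summand 0 goes into the slack of the length bound, the top element into the count of copies
    -- of `b`, and any other one into the list.
    Rep-∷ : ∀ {m N x} → x ∈ A → Rep m N → ∃[ y ] x ≡ + y × Rep (y ℕ.+ m) (suc N)
    Rep-∷ {m} {N} (zero , refl) r = 0 , a₀≡0 , Rep-mono (ℕₚ.n≤1+n N) r
    Rep-∷ {m} {N} (suc i , refl) r@(xs , u , xs∈ , total , len) = ∣ a (suc i) ∣ , sym (abs-pos i) , cons (view i)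
      where
      cons : ∀ {i} → View i → Rep (∣ a (suc i) ∣ ℕ.+ m) (suc N)
      cons ‵fromℕ       = subst (λ s → Rep s (suc N)) (ℕₚ.+-comm m bℕ) (Rep-+b r)
      cons (‵inject₁ j) = _ ∷ xs , u , ∈-tabulate⁺ j ∷ xs∈ ,
        trans (ℕₚ.+-assoc _ (sum xs) (u ℕ.* bℕ)) (cong (ℕ._+_ _) total) , s≤s len

    ⋆⇒Rep : ∀ N {n} → n ∈ N ⋆ A → ∃[ m ] n ≡ + m × Rep m N
    ⋆⇒Rep zero    (x , x∈ , refl) = 0 , refl , [] , 0 , [] , refl , z≤n
    ⋆⇒Rep (suc N) (x , x∈ , refl)
      with m , rest≡ , r ← ⋆⇒Rep N (tail x , (λ i → x∈ (suc i)) , refl)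
      with y , x₀≡ , r′ ← Rep-∷ (x∈ zero) r = y ℕ.+ m , cong₂ ℤ._+_ x₀≡ rest≡ , r′

    -- Replacing each summand `b - s` by `s` lets sums over `b − A` be handled through
    -- representations for `A` itself.
    complement-⋆⇒Rep : ∀ N {n} → n ∈ N ⋆ (b − A) → ∃[ m ] b * + N - n ≡ + m × Rep m N
    complement-⋆⇒Rep zero    (x , x∈ , refl) = 0 , cong (_- 0ℤ) (ℤₚ.*-zeroʳ b) , [] , 0 , [] , refl , z≤n
    complement-⋆⇒Rep (suc N) (x , x∈ , refl)
      with m , rest≡ , r ← complement-⋆⇒Rep N (tail x , (λ i → x∈ (suc i)) , refl)
      with s , s∈ , x₀≡ ← x∈ zero
      with y , s≡ , r′ ← Rep-∷ s∈ r = y ℕ.+ m , total , r′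
      where
      open ≡-Reasoning
      eq : ∀ b N s t → b * (1ℤ ℤ.+ N) - (b - s ℤ.+ t) ≡ s ℤ.+ (b * N - t)
      eq = ℤ-solve-∀
      total : b * + suc N - (x zero ℤ.+ ∑ (tail x)) ≡ + (y ℕ.+ m)
      total = begin
        b * + suc N - (x zero ℤ.+ ∑ (tail x))          ≡⟨ cong (λ c → b * + suc N - (c ℤ.+ ∑ (tail x))) x₀≡ ⟨
        b * + suc N - (b - s ℤ.+ ∑ (tail x))           ≡⟨ eq b (+ N) s (∑ (tail x)) ⟩
        s ℤ.+ (b * + N - ∑ (tail x))                   ≡⟨ cong₂ ℤ._+_ s≡ rest≡ ⟩
        + (y ℕ.+ m)                                    ∎

    complement-⋆ : ∀ N {n} → n ∈ N ⋆ A → (b * + N - n) ∈ N ⋆ (b − A)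
    complement-⋆ zero    (x , x∈ , refl) = (λ ()) , (λ ()) , sym (cong (_- 0ℤ) (ℤₚ.*-zeroʳ b))
    complement-⋆ (suc N) (x , x∈ , refl) = subst (_∈ suc N ⋆ (b − A)) (eq b (+ N) (x zero) (∑ (tail x)))
      (∷-⋆ {A = b − A} (x zero , x∈ zero , refl) (complement-⋆ N (tail x , (λ i → x∈ (suc i)) , refl)))
      where
      eq : ∀ b N s t → b - s ℤ.+ (b * N - t) ≡ b * (1ℤ ℤ.+ N) - (s ℤ.+ t)
      eq = ℤ-solve-∀

    Rep⇒⋆ : ∀ {m N} → Rep m N → + m ∈ N ⋆ A
    Rep⇒⋆ {m} {N} (xs , u , xs∈ , total , len) = subst₂ (λ n K → n ∈ K ⋆ A)
      (cong +_ total) (trans (sym (ℕₚ.+-assoc (length xs) u _)) (ℕₚ.m+[n∸m]≡n len)) (elements xs∈)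
      where
      z = N ℕ.∸ (length xs ℕ.+ u)
      zeros : ∀ z → 0ℤ ∈ z ⋆ A
      zeros zero    = (λ ()) , (λ ()) , refl
      zeros (suc z) = ∷-⋆ {A = A} 0∈A (zeros z)
      copies : ∀ u → + (u ℕ.* bℕ) ∈ (u ℕ.+ z) ⋆ A
      copies zero    = zeros z
      copies (suc u) = ∷-⋆ {A = A} (subst (_∈ A) (sym +bℕ≡b) b∈A) (copies u)
      elements : ∀ {xs} → All (_∈ₗ A′) xs → + (sum xs ℕ.+ u ℕ.* bℕ) ∈ (length xs ℕ.+ (u ℕ.+ z)) ⋆ A
      elements []                  = copies u
      elements {x ∷ xs} (x∈ ∷ xs∈) = subst (λ s → + s ∈ (suc (length xs ℕ.+ (u ℕ.+ z))) ⋆ A)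
        (sym (ℕₚ.+-assoc x (sum xs) (u ℕ.* bℕ))) (∷-⋆ {A = A} (A′⊆A x∈) (elements xs∈))

    Rep-bound : ∀ {m N} → Rep m N → m ℕ.≤ bℕ ℕ.* N
    Rep-bound {m} {N} (xs , u , xs∈ , total , len) = begin
      m                                      ≡⟨ total ⟨
      sum xs ℕ.+ u ℕ.* bℕ                    ≤⟨ ℕₚ.+-monoˡ-≤ _ (ℕₚ.≤-trans (ℕₚ.m≤m+n _ _) (sum-bound xs∈)) ⟩
      length xs ℕ.* bℕ ℕ.+ u ℕ.* bℕ          ≡⟨ ℕₚ.*-distribʳ-+ bℕ (length xs) u ⟨
      (length xs ℕ.+ u) ℕ.* bℕ               ≤⟨ ℕₚ.*-monoˡ-≤ bℕ len ⟩
      N ℕ.* bℕ                               ≡⟨ ℕₚ.*-comm N bℕ ⟩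
      bℕ ℕ.* N                               ∎
      where open ℕₚ.≤-Reasoning

    b*+≡ : ∀ N → b * + N ≡ + (bℕ ℕ.* N)
    b*+≡ N = trans (cong (_* + N) (sym +bℕ≡b)) (sym (ℤₚ.pos-* bℕ N))

    -- `𝒫` begins with one summand; the empty sum is 0 and thus excluded by positivity.
    positive-⋆⇒𝒫 : ∀ {S : ℤSet} N {n} → 1ℤ ℤ.≤ n → n ∈ N ⋆ S → n ∈ 𝒫 S
    positive-⋆⇒𝒫 zero    1≤n (_ , _ , refl) with () ← ℤₚ.drop‿+≤+ 1≤n
    positive-⋆⇒𝒫 (suc N) 1≤n n∈ = suc N , s≤s z≤n , n∈

  -- The two inclusions.

  sumset-structure : (N : ℕ) → + N ≥ b - + ℓ → N ⋆ A ≐ [0⋯ b * + N ] ∖ (ℰ A ∪ (b * + N − ℰ (b − A)))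
  sumset-structure N N≥ = forward , backward
    where
    forward : ∀ {n} → n ∈ N ⋆ A → n ∈ [0⋯ b * + N ] ∖ (ℰ A ∪ (b * + N − ℰ (b − A)))
    forward {n} n∈ with m , refl , r ← ⋆⇒Rep N n∈ =
      (ℤ.+≤+ z≤n , subst (+ m ℤ.≤_) (sym (b*+≡ N)) (ℤ.+≤+ (Rep-bound r))) , λ where
        (inj₁ (1≤n , n∉)) → n∉ (positive-⋆⇒𝒫 {A} N 1≤n n∈)
        (inj₂ (s , (1≤s , s∉) , bN-s≡n)) → s∉ (positive-⋆⇒𝒫 {b − A} N 1≤s
          (subst (_∈ N ⋆ (b − A)) (trans (cong (b * + N -_) (sym bN-s≡n)) (eq (b * + N) s)) (complement-⋆ N n∈)))
      where
      eq : ∀ c s → c - (c - s) ≡ s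
      eq = ℤ-solve-∀

    bℕ≤ : bℕ ℕ.≤ N ℕ.+ length A′
    bℕ≤ = subst (λ l → bℕ ℕ.≤ N ℕ.+ l) (sym (Listₚ.length-tabulate (λ (i : Fin ℓ) → ∣ a (suc (inject₁ i)) ∣)))
      (subst (ℕ._≤ N ℕ.+ ℓ) (ℕₚ.+-identityʳ bℕ) (Differences.diff-cancel-≤ bℕ ℓ N 0
        (subst₂ ℤ._≤_ (cong (_- + ℓ) (sym +bℕ≡b)) (sym (ℤₚ.+-identityʳ (+ N))) N≥)))

    backward : ∀ {n} → n ∈ [0⋯ b * + N ] ∖ (ℰ A ∪ (b * + N − ℰ (b − A))) → n ∈ N ⋆ A
    -- Not being exceptional gives representations only under a double negation, which the
    -- decidability of the goal removes.
    backward {+ m} ((_ , n≤) , not-exceptional) = decidable-stable (⋆-dec a N (+ m)) λ n∉ →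
      head-part λ (s , rep-a) → tail-part λ (t , rep-c) → ¬¬-Rep s t bℕ≤ rep-a rep-c λ r → n∉ (Rep⇒⋆ r)
      where
      head-part : ¬ ¬ (∃[ s ] Rep m (N ℕ.+ s))
      head-part ¬rep with m ℕₚ.≟ 0
      -- `ℰ` has only positive elements, so 0 is represented directly by the empty sum.
      ... | yes refl = ¬rep (0 , [] , 0 , [] , refl , z≤n)
      ... | no m≢0 = not-exceptional (inj₁ (ℤ.+≤+ (ℕₚ.n≢0⇒n>0 m≢0) , λ (K , _ , n∈) → from K (⋆⇒Rep K n∈)))
        where
        from : ∀ K → ¬ (∃[ m′ ] + m ≡ + m′ × Rep m′ K)
        from K (_ , refl , r) = ¬rep (K , Rep-mono (ℕₚ.m≤n+m K N) r)

      d = bℕ ℕ.* N ℕ.∸ m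

      m+d≡ : m ℕ.+ d ≡ bℕ ℕ.* N
      m+d≡ = ℕₚ.m+[n∸m]≡n (ℤₚ.drop‿+≤+ (subst (+ m ℤ.≤_) (b*+≡ N) n≤))

      b*N≡ : b * + N ≡ + m ℤ.+ + d
      b*N≡ = trans (b*+≡ N) (cong +_ (sym m+d≡))

      tail-part : ¬ ¬ (∃[ t ] Rep (m ℕ.+ t ℕ.* bℕ) (N ℕ.+ t))
      tail-part ¬rep with d ℕₚ.≟ 0
      -- Likewise for the top value `b * N`, which is `N` copies of `b`.
      ... | yes d≡0 = ¬rep (0 , [] , N , [] , total , ℕₚ.m≤m+n N 0)
        where
        total : N ℕ.* bℕ ≡ m ℕ.+ 0
        total = trans (ℕₚ.*-comm N bℕ) (trans (sym m+d≡) (cong (ℕ._+_ m) d≡0))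
      ... | no d≢0 = not-exceptional (inj₂ (+ d , (ℤ.+≤+ (ℕₚ.n≢0⇒n>0 d≢0) , λ (K , _ , d∈) → from K (complement-⋆⇒Rep K d∈)) ,
              trans (cong (_- + d) b*N≡) (eq (+ m) (+ d))))
        where
        eq : ∀ m d → m ℤ.+ d - d ≡ m
        eq = ℤ-solve-∀
        from : ∀ K → ¬ (∃[ m′ ] b * + K - + d ≡ + m′ × Rep m′ K)
        -- `K` serves as `t`: adding `N` copies of `b` to `b * K - d` gives `m + K * b`, in at most
        -- `N + K` summands.
        from K (m′ , bK-d≡m′ , xs , u , xs∈ , total , len) = ¬rep (K , xs , u ℕ.+ N , xs∈ , total′ , len′)
          where
          bK≡ : bℕ ℕ.* K ≡ m′ ℕ.+ d
          bK≡ = ℤₚ.+-injective (trans (sym (b*+≡ K)) (trans (eq′ (b * + K) (+ d)) (cong (ℤ._+ + d) bK-d≡m′)))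
            where
            eq′ : ∀ c d → c ≡ c - d ℤ.+ d
            eq′ = ℤ-solve-∀

          total′ : sum xs ℕ.+ (u ℕ.+ N) ℕ.* bℕ ≡ m ℕ.+ K ℕ.* bℕ
          total′ = ℕₚ.+-cancelʳ-≡ d _ _ (begin
            sum xs ℕ.+ (u ℕ.+ N) ℕ.* bℕ ℕ.+ d                    ≡⟨ eq₁ (sum xs) u N bℕ d ⟩
            sum xs ℕ.+ u ℕ.* bℕ ℕ.+ d ℕ.+ bℕ ℕ.* N               ≡⟨ cong₂ (λ p q → p ℕ.+ d ℕ.+ q) total (sym m+d≡) ⟩
            m′ ℕ.+ d ℕ.+ (m ℕ.+ d)                               ≡⟨ cong (ℕ._+ (m ℕ.+ d)) bK≡ ⟨
            bℕ ℕ.* K ℕ.+ (m ℕ.+ d)                               ≡⟨ eq₂ bℕ K m d ⟩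
            m ℕ.+ K ℕ.* bℕ ℕ.+ d                                 ∎)
            where
            open ≡-Reasoning
            eq₁ : ∀ s u N b d → s ℕ.+ (u ℕ.+ N) ℕ.* b ℕ.+ d ≡ s ℕ.+ u ℕ.* b ℕ.+ d ℕ.+ b ℕ.* N
            eq₁ = ℕ-solve-∀
            eq₂ : ∀ b K m d → b ℕ.* K ℕ.+ (m ℕ.+ d) ≡ m ℕ.+ K ℕ.* b ℕ.+ d
            eq₂ = ℕ-solve-∀

          len′ : length xs ℕ.+ (u ℕ.+ N) ℕ.≤ N ℕ.+ K
          len′ = subst₂ ℕ._≤_ (ℕₚ.+-assoc (length xs) u N) (ℕₚ.+-comm K N) (ℕₚ.+-monoˡ-≤ N len)

theorem1 : (ℓ : ℕ) → ℓ ℕ.≥ 1 →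
    (a : Vector ℤ (2 ℕ.+ ℓ)) → a Preserves Fin._<_ ⟶ _<_ → head a ≡ 0ℤ →
    gcdᵛ (tail a) ≡ 1ℤ →
    let A = range a
        b = last a in
    (N : ℕ) → + N ≥ b - + ℓ →
    N ⋆ A ≐ [0⋯ b * + N ] ∖ (ℰ A ∪ (b * + N − ℰ (b − A)))
theorem1 ℓ _ a a-mono a₀≡0 _ = sumset-structure ℓ a a-mono a₀≡0
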